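{- For integers $m\ge n\ge 1$ let $\beta(m,n)$ denote the supremum of the Braess Ratio $BR$ over all demands $q>0$, all coefficients $a>0$, $b,c,d\ge0$, and all chords $u\to v$, for the directed grid $G_{m,n}$ with source $(0,0)$, sink $(m,n)$, latency $ax+b$ on every grid edge and latency $cx+d$ on the chord. Then there is a function $g:(0,1]\to\mathbb R$ with $g(r)=O(r^3)$ as $r\to0^+$ such that for every rational aspect ratio $r=n/m\in(0,1]$, \[ \limsup_{\substack{m\to\infty\\ rm\in\mathbb Z}}\ \beta(m,rm)\ \le\ \frac43-\frac29\,r+\frac{19}{108}\,r^2+g(r). \]
   Context: Grid: $G_{m,n}=(V,E)$ is the directed graph with vertex set $V=\{0,\dots,m\}\times\{0,\dots,n\}$ and directed edges $(i,j)\to(i+1,j)$ for $i<m$ and $(i,j)\to(i,j+1)$ for $j<n$; $s=(0,0)$, $t=(m,n)$. Chord: an added directed edge $u\to v$ with $u,v\in V$, $u\ne v$, such that $uv$ is not an edge of the underlying undirected grid. Feasible flow (in the grid, or in the grid plus chord): a nonnegative number $f_e$ for each directed edge $e$, with flow conserved at every vertex other than $s,t$, and net outflow from $s$ and net inflow to $t$ both equal to $q$. Its cost is $C(f)=\sum_e f_e\ell_e(f_e)$, where $\ell_e$ is the latency function of $e$. User Equilibrium: a feasible flow, decomposable into flows along $s$-$t$ paths, such that every path carrying positive flow has latency (sum of $\ell_e(f_e)$ over its edges) no larger than that of any other $s$-$t$ path. By a classical theorem (Beckmann, McGuire, Winsten) these are exactly the minimizers over feasible flows of the Beckmann potential $Z(f)=\sum_e\int_0^{f_e}\ell_e(y)\,dy$;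 in the networks considered here the minimizer is unique. Braess Ratio: $BR=C_{\mathrm{new}}/C_{\mathrm{old}}$, where $C_{\mathrm{old}}$ is the cost of the User Equilibrium of $G_{m,n}$ and $C_{\mathrm{new}}$ is the cost of the User Equilibrium of $G_{m,n}$ with the chord added (same $s,t,q$). -}

module Defs where

open import Algebra.Bundles using (CommutativeRing; Semiring)
import Algebra.Definitions.RawSemiring as RawSemiringOps
open import Data.Fin.Base using (Fin; suc; inject₁; fromℕ) renaming (zero to fzero)
import Data.Fin.Properties as Fin
open import Data.List.Base
  using (List; []; _∷_; _++_; map; foldr; filter; allFin; cartesianProduct)
open import Data.List.Membership.Propositional using (_∈_)
open import Data.List.Membership.Propositional.Properties
  using (∈-map⁺; ∈-map⁻; ∈-++⁺ˡ; ∈-++⁺ʳ; ∈-cartesianProduct⁺; ∈-allFin)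
import Data.List.Membership.DecPropositional as DecMembership
open import Data.List.Relation.Unary.All using (All; tabulate)
open import Data.List.Relation.Unary.Any using (here; there)
open import Data.List.Relation.Unary.AllPairs using (_∷_)
open import Data.List.Relation.Unary.Unique.Propositional using (Unique)
import Data.List.Relation.Unary.Unique.Propositional.Properties as Unique
open import Data.Maybe.Base using (Maybe; just; nothing; maybe′)
import Data.Maybe.Properties as Maybe
open import Data.Nat.Base as ℕ using (ℕ)
open import Data.Product.Base using (Σ; ∃; ∃₂; _×_; _,_; proj₁; proj₂; uncurry)
import Data.Product.Properties as Product
open import Data.Sum.Base using (_⊎_; inj₁; inj₂; [_,_]′)
import Data.Sum.Properties as Sum
open import Function.Base using (_∘_; const)
open import Level using (0ℓ) renaming (suc to lsuc)
open import Relation.Binary.Core using (Rel)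
open import Relation.Binary.Definitions using (DecidableEquality)
open import Relation.Binary.Structures using (IsDecTotalOrder)
open import Relation.Binary.PropositionalEquality.Core using (_≡_; _≢_; refl)
import Relation.Binary.Construct.Add.Extrema.NonStrict as AddExtrema
import Relation.Binary.Construct.NonStrictToStrict as NonStrictToStrict
open import Relation.Binary.Construct.Closure.ReflexiveTransitive using (Star; ε; _◅_)
open import Relation.Nullary.Construct.Add.Extrema using (_±; [_])
open import Relation.Nullary.Negation using (¬_)
open import Relation.Unary using (Pred)

module Bounds {A : Set} (_≤_ : Rel A 0ℓ) where

  UpperBound LowerBound IsSup IsInf : Pred A 0ℓ → Pred A 0ℓ
  UpperBound P u = ∀ x → P x → x ≤ u
  LowerBound P l = ∀ x → P x → l ≤ x
  IsSup P s = UpperBound P s × (∀ u → UpperBound P u → s ≤ u)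
  IsInf P i = LowerBound P i × (∀ l → LowerBound P l → l ≤ i)

------------------------------------------------------------------------
-- The standard library has no type of real numbers; ℝ enters through its
-- axiomatic characterisation as a Dedekind-complete ordered field, with the
-- equality of the underlying ring as equality.  The value of 0# ⁻¹ is left
-- unspecified.  Classically `archimedean` follows from `complete`; it is
-- listed because a supremum in the sense of IsSup does not constructively
-- produce a natural number.

record CompleteOrderedField : Set (lsuc 0ℓ) where
  field
    commutativeRing : CommutativeRing 0ℓ 0ℓ

  open CommutativeRing commutativeRing public
  open RawSemiringOps (Semiring.rawSemiring semiring) public using (_^_) renaming (_×_ to _·_)

  infix 8 _⁻¹
  infix 4 _≤_

  field
    _≤_             : Rel Carrier 0ℓ
    isDecTotalOrder : IsDecTotalOrder _≈_ _≤_
    +-monoʳ-≤       : ∀ x {y z} → y ≤ z → x + y ≤ x + z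
    *-nonNegative   : ∀ {x y} → 0# ≤ x → 0# ≤ y → 0# ≤ x * y
    0≉1             : ¬ 0# ≈ 1#
    _⁻¹             : Carrier → Carrier
    ⁻¹-cong         : ∀ {x y} → x ≈ y → x ⁻¹ ≈ y ⁻¹
    *-inverseʳ      : ∀ x → ¬ x ≈ 0# → x * x ⁻¹ ≈ 1#
    archimedean     : ∀ x → ∃ λ n → x ≤ n · 1#
    complete        : (P : Pred Carrier 0ℓ) → ∃ P → ∃ (Bounds.UpperBound _≤_ P) →
                      ∃ (Bounds.IsSup _≤_ P)

  open NonStrictToStrict _≈_ _≤_ public using (_<_)
  private module Order = IsDecTotalOrder isDecTotalOrder

  infixl 7 _/_
  _/_ : Carrier → Carrier → Carrier
  x / y = x * y ⁻¹

  nat : ℕ → Carrier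
  nat n = n · 1#

  ∣_∣ : Carrier → Carrier
  ∣ x ∣ = [ const x , const (- x) ]′ (Order.total 0# x)

  ∑ : {A : Set} → List A → (A → Carrier) → Carrier
  ∑ xs f = foldr _+_ 0# (map f xs)

------------------------------------------------------------------------
-- `arcs` lists every arc exactly once.

record Network : Set (lsuc 0ℓ) where
  field
    Vertex   : Set
    Arc      : Set
    _≟ⱽ_     : DecidableEquality Vertex
    _≟ᴬ_     : DecidableEquality Arc
    arcs     : List Arc
    complete : ∀ e → e ∈ arcs
    unique   : Unique arcs
    src tgt  : Arc → Vertex
    s t      : Vertex

  _⟶_ : Rel Vertex 0ℓ
  u ⟶ v = Σ Arc λ e → src e ≡ u × tgt e ≡ v

  Walk : Rel Vertex 0ℓ
  Walk = Star _⟶_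

  walkArcs : ∀ {u v} → Walk u v → List Arc
  walkArcs ε             = []
  walkArcs ((e , _) ◅ p) = e ∷ walkArcs p

  walkVertices : ∀ {u v} → Walk u v → List Vertex
  walkVertices {u} ε       = u ∷ []
  walkVertices {u} (_ ◅ p) = u ∷ walkVertices p

  Path : Set
  Path = Σ (Walk s t) (Unique ∘ walkVertices)

  pathArcs : Path → List Arc
  pathArcs = walkArcs ∘ proj₁

  open DecMembership _≟ᴬ_ public using (_∈?_)

------------------------------------------------------------------------
-- The grid G m n.

GridVertex : ℕ → ℕ → Set
GridVertex m n = Fin (ℕ.suc m) × Fin (ℕ.suc n)

GridArc : ℕ → ℕ → Set
GridArc m n = (Fin m × Fin (ℕ.suc n)) ⊎ (Fin (ℕ.suc m) × Fin n)

gridSrc gridTgt : ∀ {m n} → GridArc m n → GridVertex m n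
gridSrc (inj₁ (i , j)) = inject₁ i , j
gridSrc (inj₂ (i , j)) = i , inject₁ j
gridTgt (inj₁ (i , j)) = suc i , j
gridTgt (inj₂ (i , j)) = i , suc j

gridArcs : ∀ m n → List (GridArc m n)
gridArcs m n = map inj₁ (cartesianProduct (allFin m) (allFin (ℕ.suc n)))
            ++ map inj₂ (cartesianProduct (allFin (ℕ.suc m)) (allFin n))

private
  gridArcs-complete : ∀ m n (e : GridArc m n) → e ∈ gridArcs m n
  gridArcs-complete m n (inj₁ (i , j)) =
    ∈-++⁺ˡ (∈-map⁺ inj₁ (∈-cartesianProduct⁺ (∈-allFin i) (∈-allFin j)))
  gridArcs-complete m n (inj₂ (i , j)) =
    ∈-++⁺ʳ _ (∈-map⁺ inj₂ (∈-cartesianProduct⁺ (∈-allFin i) (∈-allFin j)))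

  gridArcs-unique : ∀ m n → Unique (gridArcs m n)
  gridArcs-unique m n = Unique.++⁺
    (Unique.map⁺ Sum.inj₁-injective
      (Unique.cartesianProduct⁺ (Unique.allFin⁺ m) (Unique.allFin⁺ (ℕ.suc n))))
    (Unique.map⁺ Sum.inj₂-injective
      (Unique.cartesianProduct⁺ (Unique.allFin⁺ (ℕ.suc m)) (Unique.allFin⁺ n)))
    disjoint
    where
    disjoint : ∀ {e} → ¬ (e ∈ map inj₁ (cartesianProduct (allFin m) (allFin (ℕ.suc n)))
                        × e ∈ map inj₂ (cartesianProduct (allFin (ℕ.suc m)) (allFin n)))
    disjoint (p , q) with ∈-map⁻ inj₁ p | ∈-map⁻ inj₂ q
    ... | _ , _ , refl | _ , _ , ()

grid : ℕ → ℕ → Network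
grid m n = record
  { Vertex   = GridVertex m n
  ; Arc      = GridArc m n
  ; _≟ⱽ_     = Product.≡-dec Fin._≟_ Fin._≟_
  ; _≟ᴬ_     = Sum.≡-dec (Product.≡-dec Fin._≟_ Fin._≟_) (Product.≡-dec Fin._≟_ Fin._≟_)
  ; arcs     = gridArcs m n
  ; complete = gridArcs-complete m n
  ; unique   = gridArcs-unique m n
  ; src      = gridSrc
  ; tgt      = gridTgt
  ; s        = fzero , fzero
  ; t        = fromℕ m , fromℕ n
  }

record Chord (m n : ℕ) : Set where
  field
    from to     : GridVertex m n
    from≢to     : from ≢ to
    notGridEdge : ∀ (e : GridArc m n) → ¬ (gridSrc e ≡ from × gridTgt e ≡ to)
                                      × ¬ (gridSrc e ≡ to × gridTgt e ≡ from)

-- The chord is the arc `nothing`.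
gridWithChord : ∀ m n → Chord m n → Network
gridWithChord m n ch = record
  { Vertex   = Vertex
  ; Arc      = Maybe Arc
  ; _≟ⱽ_     = _≟ⱽ_
  ; _≟ᴬ_     = Maybe.≡-dec _≟ᴬ_
  ; arcs     = nothing ∷ map just arcs
  ; complete = λ { nothing → here refl ; (just e) → there (∈-map⁺ just (complete e)) }
  ; unique   = tabulate nothing≢ ∷ Unique.map⁺ Maybe.just-injective unique
  ; src      = maybe′ src (Chord.from ch)
  ; tgt      = maybe′ tgt (Chord.to ch)
  ; s        = s
  ; t        = t
  }
  where
  open Network (grid m n)
  nothing≢ : ∀ {e} → e ∈ map just arcs → nothing ≢ e
  nothing≢ p refl with ∈-map⁻ just p
  ... | _ , _ , ()

------------------------------------------------------------------------

module Flows (ℝ : CompleteOrderedField) (N : Network)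
             (ℓ : Network.Arc N → CompleteOrderedField.Carrier ℝ →
                  CompleteOrderedField.Carrier ℝ) where

  open CompleteOrderedField ℝ hiding (complete)
  open Network N

  Flow : Set
  Flow = Arc → Carrier

  inflow outflow : Flow → Vertex → Carrier
  inflow  f v = ∑ (filter (λ e → tgt e ≟ⱽ v) arcs) f
  outflow f v = ∑ (filter (λ e → src e ≟ⱽ v) arcs) f

  record Feasible (q : Carrier) (f : Flow) : Set where
    field
      nonNegative  : ∀ e → 0# ≤ f e
      conservation : ∀ v → v ≢ s → v ≢ t → outflow f v ≈ inflow f v
      source       : outflow f s - inflow f s ≈ q
      sink         : inflow f t - outflow f t ≈ q

  cost : Flow → Carrier
  cost f = ∑ arcs λ e → f e * ℓ e (f e)

  latency : Flow → Path → Carrier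
  latency f p = ∑ (pathArcs p) λ e → ℓ e (f e)

  -- Finitely many paths, each with the amount of flow it carries.
  PathFlow : Set
  PathFlow = List (Path × Carrier)

  record UserEquilibrium (q : Carrier) (f : Flow) : Set where
    field
      feasible      : Feasible q f
      pathFlow      : PathFlow
      nonNegative   : All (λ (_ , x) → 0# ≤ x) pathFlow
      decomposition : ∀ e →
        f e ≈ ∑ (filter (λ (p , _) → e ∈? pathArcs p) pathFlow) proj₂
      equilibrium   :
        All (λ (p , x) → 0# < x → ∀ p′ → latency f p ≤ latency f p′) pathFlow

module Braess (ℝ : CompleteOrderedField) where

  open CompleteOrderedField ℝ public
  open AddExtrema _≤_ public using (_≤±_)

  affine : Carrier → Carrier → Carrier → Carrier
  affine a b x = a * x + b

  record Instance (m n : ℕ) : Set where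
    field
      q a b c d : Carrier
      0<q       : 0# < q
      0<a       : 0# < a
      0≤b       : 0# ≤ b
      0≤c       : 0# ≤ c
      0≤d       : 0# ≤ d
      chord     : Chord m n

    module Old = Flows ℝ (grid m n) (const (affine a b))
    module New = Flows ℝ (gridWithChord m n chord)
                         (maybe′ (const (affine a b)) (affine c d))

    field
      fOld   : Old.Flow
      fOldUE : Old.UserEquilibrium q fOld
      fNew   : New.Flow
      fNewUE : New.UserEquilibrium q fNew

    braessRatio : Carrier
    braessRatio = New.cost fNew / Old.cost fOld

  -- Suprema and upper limits are taken in the extended reals, where they
  -- always exist (classically).
  ℝ± : Set
  ℝ± = Carrier ±

  BraessRatios : ℕ → ℕ → Pred ℝ± 0ℓ
  BraessRatios m n y = Σ (Instance m n) λ I → y ≡ [ Instance.braessRatio I ]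

  IsSupBraessRatio : (ℕ → ℕ → ℝ±) → Set
  IsSupBraessRatio β =
    ∀ m n → 1 ℕ.≤ n → n ℕ.≤ m → Bounds.IsSup _≤±_ (BraessRatios m n) (β m n)

  -- L is the limsup of β m (r m) over m → ∞ with r m an integer: the infimum
  -- of all U that eventually bound the sequence from above.
  IsLimSupAlong : Carrier → (ℕ → ℕ → ℝ±) → ℝ± → Set
  IsLimSupAlong r β = Bounds.IsInf _≤±_ λ U →
    ∃ λ M → ∀ m n → M ℕ.≤ m → nat n ≈ r * nat m → β m n ≤± U

  ⟨0,1] : Set
  ⟨0,1] = Σ Carrier λ r → 0# < r × r ≤ 1#

  record Function : Set where
    field
      _⟨_⟩ : ⟨0,1] → Carrier
      cong : ∀ {r r′} → proj₁ r ≈ proj₁ r′ → _⟨_⟩ r ≈ _⟨_⟩ r′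

  open Function public using (_⟨_⟩)

  IsO[r³] : Function → Set
  IsO[r³] g = ∃₂ λ K δ → 0# < δ × (∀ r → proj₁ r < δ → ∣ g ⟨ r ⟩ ∣ ≤ K * proj₁ r ^ 3)

  -- Only applied to r in (0,1], so natural numerators suffice.
  Rational : Carrier → Set
  Rational r = ∃₂ λ k l → 1 ℕ.≤ l × r ≈ nat k / nat l

{-# OPTIONS --safe #-}

-- The bound is met with room to spare: every Braess ratio is at most 2, and at most 5/4
-- when 8n ≤ m, so the error term may be taken to be 0 for r ≤ 1/8 and 1 beyond.
--
-- Let h = ∇φ be the electrical flow of the grid.  By the maximum principle φ decreases in
-- both coordinates, so h ≥ 0.  Write H = ⟨h,h⟩ (minimal among grid flows) and
-- S = m + n, so that C_old ≥ aH + bqS, and let g be the grid part of the new equilibrium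
-- and x the flow on the chord u → v.  The variational inequality tested with h gives
-- C_new ≤ a⟨h,g⟩ + bqS, where ⟨h,g⟩ = H + x(φ(v) − φ(u)) because h is a gradient.
-- Let K = |v| − |u| be the number of grid steps the chord saves.  Cauchy–Schwarz
-- also yields C_new ≤ aH + bqS + bxK, which suffices when 4K ≤ S.  Otherwise, on a thin
-- grid, the chord crosses at least m/8 columns.  The potential drops along all columns
-- sum to nq, and each crossed column drops by at least φ(v) − φ(u), so this rise is
-- O(qn/m), negligible against H ≥ q²m/(n+1).

module Submission where

open import Defs
open import Algebra.Bundles using (RawRing)
import Algebra.Properties.AbelianGroup as AbelianGroupProperties
import Algebra.Properties.Ring as RingProperties
import Algebra.Properties.Semiring.Mult as SemiringMult
import Algebra.Solver.Ring as RingSolver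
open import Algebra.Solver.Ring.AlmostCommutativeRing
  using (fromCommutativeRing; _-Raw-AlmostCommutative⟶_)
open import Data.Bool.Base using (if_then_else_)
open import Data.Empty using (⊥-elim)
open import Data.Fin.Base as Fin using (Fin; inject₁; fromℕ; toℕ)
open import Data.Fin.Induction using (<-weakInduction; <-weakInduction-startingFrom)
import Data.Fin.Properties as Fin
open import Data.Fin.Relation.Unary.Top using (view; ‵fromℕ; ‵inject₁)
open import Data.Integer.Base as ℤ using (ℤ; +_; -[1+_]; _⊖_)
import Data.Integer.Properties as ℤ
open import Data.List.Base
  using (List; []; _∷_; _++_; map; foldr; filter; allFin; tabulate; cartesianProduct)
import Data.List.Extrema as Extrema
import Data.List.Properties as List
open import Data.List.Membership.Propositional using (_∈_)
open import Data.List.Membership.Propositional.Properties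
  using (∈-filter⁺; ∈-filter⁻; ∈-allFin; ∈-map⁺; ∈-cartesianProduct⁺)
open import Data.List.Membership.Propositional.Properties.WithK using (unique∧set⇒bag)
open import Data.List.Relation.Binary.BagAndSetEquality using (∼bag⇒↭)
open import Data.List.Relation.Binary.Permutation.Propositional as Perm using (_↭_)
open import Data.List.Relation.Unary.All as All using (All; []; _∷_)
open import Data.List.Relation.Unary.AllPairs using ([]; _∷_)
open import Data.List.Relation.Unary.Any using (here; there)
open import Data.List.Relation.Unary.Unique.Propositional using (Unique)
import Data.List.Relation.Unary.Unique.Propositional.Properties as Unique
open import Data.Maybe.Base using (just; nothing; maybe′)
open import Data.Nat.Base as ℕ using (ℕ; zero; suc)
import Data.Nat.Properties as ℕ
open import Data.Product.Base using (∃; Σ-syntax; _×_; _,_; proj₁; proj₂; uncurry)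
open import Data.Sign.Base as Sign using (Sign)
open import Data.Sum.Base using (_⊎_; inj₁; inj₂)
open import Function.Base using (id; const; flip; _∘_)
open import Function.Bundles using (_⇔_; mk⇔; Equivalence)
open import Relation.Binary.Bundles using (TotalOrder)
import Relation.Binary.Construct.Add.Extrema.NonStrict as AddExtrema
open import Relation.Binary.Construct.Closure.ReflexiveTransitive using (ε; _◅_)
open import Relation.Binary.Definitions using (DecidableEquality; WeaklyDecidable)
import Relation.Binary.PropositionalEquality.Core as ≡
open ≡ using (_≡_; _≢_)
open import Relation.Binary.Structures using (IsDecTotalOrder)
open import Relation.Nullary.Construct.Add.Extrema using ([_])
open import Relation.Nullary.Decidable.Core using (Dec; yes; no; does)
open import Relation.Nullary.Negation using (¬_)
open import Relation.Unary using (Pred; Decidable)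

-- The order condition on `g` bites only near r = 0, where the target is close to 4/3, so any
-- constant below 4/3 suffices on sufficiently thin grids. Both thin-grid estimates bound the ratio
-- by (k + 1)/k. With k = 3 this is 4/3 itself, which the negative linear term rules out; k = 4 fits
-- for all r ≤ 1/8. The same 1/8 makes a chord with 4K ≥ S cross at least m/8 columns, and its
-- square 64n² ≤ m² is what the comparison of rise and energy consumes. Neither estimate is enough
-- alone: the saving estimate gives only 2 for a chord with K = S, and the rise estimate is empty
-- for a chord inside one column. The electrical flow is obtained as the orthogonal projection of
-- the old equilibrium flow onto gradients, which gives both the existence of φ and H ≤ ⟨fOld,
-- fOld⟩. Conservation is used in weak form, as the pairing of a flow with the gradient of a test
-- potential: vertex indicators, coordinates, φ itself and shortest distances each extract one fact.

-- Ordered-field arithmetic and a ring solver.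

module OrderedField (ℝ : CompleteOrderedField) where

  open CompleteOrderedField ℝ hiding (complete) public
  open IsDecTotalOrder isDecTotalOrder public using (_≤?_; _≟_; total; antisym; isTotalOrder)
    renaming (refl to ≤-refl; trans to ≤-trans; reflexive to ≤-reflexive
             ; ≤-respˡ-≈ to ≤-respˡ-≈; ≤-respʳ-≈ to ≤-respʳ-≈)
  open RingProperties ring public using (-0#≈0#; -‿distribˡ-*; -‿distribʳ-*; -‿involutive)
  open AbelianGroupProperties +-abelianGroup using (⁻¹-∙-comm)
  open SemiringMult semiring using (×-homo-+; ×1-homo-*)
  open import Relation.Binary.Reasoning.Setoid setoid

  totalOrder : TotalOrder _ _ _
  totalOrder = record { isTotalOrder = isTotalOrder }

  module IntegerCoefficients where

    -- Integer coefficients let the solver's normal forms compute, which the abstract field cannot.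
    -- Since `fromℤ (+ n)` is `nat n`, `con (+ 8)` is `nat 8` definitionally; but `con (+ 1)` is
    -- `1# + 0#`, so a bare `1#` is handed to the solver as a variable.
    fromℤ : ℤ → Carrier
    fromℤ (+ n)    = nat n
    fromℤ -[1+ n ] = - nat (suc n)

    fromℤ-⊖ : ∀ m n → fromℤ (m ⊖ n) ≈ nat m - nat n
    fromℤ-⊖ zero    zero    = sym (-‿inverseʳ _)
    fromℤ-⊖ zero    (suc n) = sym (+-identityˡ _)
    fromℤ-⊖ (suc m) zero    = sym (trans (+-congˡ -0#≈0#) (+-identityʳ _))
    fromℤ-⊖ (suc m) (suc n) = begin
      fromℤ (suc m ⊖ suc n)            ≡⟨ ≡.cong fromℤ (ℤ.[1+m]⊖[1+n]≡m⊖n m n) ⟩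
      fromℤ (m ⊖ n)                    ≈⟨ fromℤ-⊖ m n ⟩
      nat m - nat n                    ≈⟨ +-congˡ (+-identityˡ _) ⟨
      nat m + (0# - nat n)             ≈⟨ +-congˡ (+-congʳ (-‿inverseʳ 1#)) ⟨
      nat m + (1# - 1# - nat n)        ≈⟨ +-congˡ (+-assoc _ _ _) ⟩
      nat m + (1# + (- 1# - nat n))    ≈⟨ +-assoc _ _ _ ⟨
      nat m + 1# + (- 1# - nat n)      ≈⟨ +-cong (+-comm _ _) (⁻¹-∙-comm _ _) ⟩
      nat (suc m) - nat (suc n)        ∎

    fromℤ-+ : ∀ i j → fromℤ (i ℤ.+ j) ≈ fromℤ i + fromℤ j
    fromℤ-+ (+ m)    (+ n)    = ×-homo-+ 1# m n
    fromℤ-+ (+ m)    -[1+ n ] = fromℤ-⊖ m (suc n)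
    fromℤ-+ -[1+ m ] (+ n)    = trans (fromℤ-⊖ n (suc m)) (+-comm _ _)
    fromℤ-+ -[1+ m ] -[1+ n ] = begin
      - nat (suc (suc (m ℕ.+ n)))    ≡⟨ ≡.cong (λ k → - nat (suc k)) (ℕ.+-suc m n) ⟨
      - nat (suc m ℕ.+ suc n)        ≈⟨ -‿cong (×-homo-+ 1# (suc m) (suc n)) ⟩
      - (nat (suc m) + nat (suc n))  ≈⟨ ⁻¹-∙-comm _ _ ⟨
      - nat (suc m) - nat (suc n)    ∎

    fromℤ-+◃ : ∀ n → fromℤ (Sign.+ ℤ.◃ n) ≈ nat n
    fromℤ-+◃ zero    = refl
    fromℤ-+◃ (suc n) = refl

    fromℤ--◃ : ∀ n → fromℤ (Sign.- ℤ.◃ n) ≈ - nat n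
    fromℤ--◃ zero    = sym -0#≈0#
    fromℤ--◃ (suc n) = refl

    fromℤ-* : ∀ i j → fromℤ (i ℤ.* j) ≈ fromℤ i * fromℤ j
    fromℤ-* (+ m)    (+ n)    = trans (fromℤ-+◃ (m ℕ.* n)) (×1-homo-* m n)
    fromℤ-* (+ m)    -[1+ n ] =
      trans (fromℤ--◃ (m ℕ.* suc n)) (trans (-‿cong (×1-homo-* m (suc n))) (-‿distribʳ-* _ _))
    fromℤ-* -[1+ m ] (+ n)    =
      trans (fromℤ--◃ (suc m ℕ.* n)) (trans (-‿cong (×1-homo-* (suc m) n)) (-‿distribˡ-* _ _))
    fromℤ-* -[1+ m ] -[1+ n ] = begin
      nat (suc m ℕ.* suc n)            ≈⟨ ×1-homo-* (suc m) (suc n) ⟩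
      nat (suc m) * nat (suc n)        ≈⟨ -‿involutive _ ⟨
      - - (nat (suc m) * nat (suc n))  ≈⟨ -‿cong (-‿distribˡ-* _ _) ⟩
      - (- nat (suc m) * nat (suc n))  ≈⟨ -‿distribʳ-* _ _ ⟩
      - nat (suc m) * - nat (suc n)    ∎

    fromℤ-‿ : ∀ i → fromℤ (ℤ.- i) ≈ - fromℤ i
    fromℤ-‿ (+ zero)  = sym -0#≈0#
    fromℤ-‿ (+ suc n) = refl
    fromℤ-‿ -[1+ n ]  = sym (-‿involutive _)

    ℤ-rawRing : RawRing _ _
    ℤ-rawRing = record
      { _≈_ = _≡_ ; _+_ = ℤ._+_ ; _*_ = ℤ._*_ ; -_ = ℤ.-_ ; 0# = + 0 ; 1# = + 1 }

    morphism : ℤ-rawRing -Raw-AlmostCommutative⟶ fromCommutativeRing commutativeRing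
    morphism = record
      { ⟦_⟧ = fromℤ ; +-homo = fromℤ-+ ; *-homo = fromℤ-* ; -‿homo = fromℤ-‿
      ; 0-homo = refl ; 1-homo = +-identityʳ 1# }

    _coeff≟_ : WeaklyDecidable (λ i j → fromℤ i ≈ fromℤ j)
    i coeff≟ j with i ℤ.≟ j
    ... | yes ≡.refl = just refl
    ... | no _       = nothing

  open RingSolver IntegerCoefficients.ℤ-rawRing (fromCommutativeRing commutativeRing)
    IntegerCoefficients.morphism IntegerCoefficients._coeff≟_ public
    using (solve; _:=_; _:+_; _:*_; _:-_; :-_; con)

  +-mono-≤ : ∀ {w x y z} → w ≤ x → y ≤ z → w + y ≤ x + z
  +-mono-≤ {w} {x} {y} {z} w≤x y≤z = ≤-trans (+-monoʳ-≤ w y≤z)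
    (≤-respˡ-≈ (+-comm z w) (≤-respʳ-≈ (+-comm z x) (+-monoʳ-≤ z w≤x)))

  -- The form in which most inequalities below are proved: `d` is a nonnegative certificate, usually
  -- inferred from the proof of `0# ≤ d`, and the ring solver checks the identity.
  ≤-by : ∀ {x y} d → 0# ≤ d → y ≈ x + d → x ≤ y
  ≤-by {x} d 0≤d y≈x+d = ≤-respˡ-≈ (+-identityʳ x) (≤-respʳ-≈ (sym y≈x+d) (+-monoʳ-≤ x 0≤d))

  x≤y⇒0≤y-x : ∀ {x y} → x ≤ y → 0# ≤ y - x
  x≤y⇒0≤y-x {x} {y} x≤y =
    ≤-respˡ-≈ (-‿inverseˡ x) (≤-respʳ-≈ (+-comm (- x) y) (+-monoʳ-≤ (- x) x≤y))

  x≤y+z⇒x-z≤y : ∀ {x y z} → x ≤ y + z → x - z ≤ y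
  x≤y+z⇒x-z≤y {x} {y} {z} x≤y+z = ≤-by (y + z - x) (x≤y⇒0≤y-x x≤y+z)
    (solve 3 (λ x y z → y := x :- z :+ (y :+ z :- x)) refl x y z)

  +-nonNegative : ∀ {x y} → 0# ≤ x → 0# ≤ y → 0# ≤ x + y
  +-nonNegative 0≤x 0≤y = ≤-respˡ-≈ (+-identityˡ 0#) (+-mono-≤ 0≤x 0≤y)

  -‿anti-≤ : ∀ {x y} → x ≤ y → - y ≤ - x
  -‿anti-≤ {x} {y} x≤y = ≤-by (y - x) (x≤y⇒0≤y-x x≤y)
    (solve 2 (λ x y → :- x := :- y :+ (y :- x)) refl x y)

  0≤x² : ∀ x → 0# ≤ x * x
  0≤x² x with total 0# x
  ... | inj₁ 0≤x = *-nonNegative 0≤x 0≤x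
  ... | inj₂ x≤0 = ≤-respʳ-≈ (solve 1 (λ x → (con (+ 0) :- x) :* (con (+ 0) :- x) := x :* x) refl x)
                     (*-nonNegative (x≤y⇒0≤y-x x≤0) (x≤y⇒0≤y-x x≤0))

  0≤1 : 0# ≤ 1#
  0≤1 = ≤-respʳ-≈ (*-identityˡ 1#) (0≤x² 1#)

  0≤nat : ∀ n → 0# ≤ nat n
  0≤nat zero    = ≤-refl
  0≤nat (suc n) = +-nonNegative 0≤1 (0≤nat n)

  nat-mono-≤ : ∀ {m n} → m ℕ.≤ n → nat m ≤ nat n
  nat-mono-≤ {n = n} ℕ.z≤n = 0≤nat n
  nat-mono-≤ (ℕ.s≤s m≤n) = +-monoʳ-≤ 1# (nat-mono-≤ m≤n)

  *-monoˡ-≤ : ∀ {x y z} → 0# ≤ z → x ≤ y → z * x ≤ z * y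
  *-monoˡ-≤ {x} {y} {z} 0≤z x≤y = ≤-by (z * (y - x)) (*-nonNegative 0≤z (x≤y⇒0≤y-x x≤y))
    (solve 3 (λ x y z → z :* y := z :* x :+ z :* (y :- x)) refl x y z)

  ≰⇒≥ : ∀ {x y} → ¬ x ≤ y → y ≤ x
  ≰⇒≥ {x} {y} x≰y with total x y
  ... | inj₁ x≤y = ⊥-elim (x≰y x≤y)
  ... | inj₂ y≤x = y≤x

  ≰⇒> : ∀ {x y} → ¬ x ≤ y → y < x
  ≰⇒> x≰y = ≰⇒≥ x≰y , λ y≈x → x≰y (≤-reflexive (sym y≈x))

  ≮⇒≥ : ∀ {x y} → ¬ x < y → y ≤ x
  ≮⇒≥ {x} {y} x≮y with y ≤? x
  ... | yes y≤x = y≤x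
  ... | no  y≰x = ⊥-elim (x≮y (≰⇒> y≰x))

  <⇒≱ : ∀ {x y} → x < y → ¬ y ≤ x
  <⇒≱ (x≤y , x≉y) y≤x = x≉y (antisym x≤y y≤x)

  0<1 : 0# < 1#
  0<1 = 0≤1 , 0≉1

  <-≤-trans : ∀ {x y z} → x < y → y ≤ z → x < z
  <-≤-trans (x≤y , x≉y) y≤z =
    ≤-trans x≤y y≤z , λ x≈z → x≉y (antisym x≤y (≤-respʳ-≈ (sym x≈z) y≤z))

  0<nat : ∀ n → 0# < nat (suc n)
  0<nat n = <-≤-trans 0<1 (≤-respˡ-≈ (+-identityʳ 1#) (+-monoʳ-≤ 1# (0≤nat n)))

  *-zero-cancelˡ : ∀ {x y} → ¬ x ≈ 0# → x * y ≈ 0# → y ≈ 0#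
  *-zero-cancelˡ {x} {y} x≉0 xy≈0 = begin
    y              ≈⟨ *-identityˡ y ⟨
    1# * y         ≈⟨ *-congʳ (*-inverseʳ x x≉0) ⟨
    x * x ⁻¹ * y   ≈⟨ solve 3 (λ x x⁻¹ y → x :* x⁻¹ :* y := x⁻¹ :* (x :* y)) refl x (x ⁻¹) y ⟩
    x ⁻¹ * (x * y) ≈⟨ *-congˡ xy≈0 ⟩
    x ⁻¹ * 0#      ≈⟨ zeroʳ _ ⟩
    0#             ∎

  x²≈0⇒x≈0 : ∀ {x} → x * x ≈ 0# → x ≈ 0#
  x²≈0⇒x≈0 {x} x²≈0 with x ≟ 0#
  ... | yes x≈0 = x≈0
  ... | no  x≉0 = *-zero-cancelˡ x≉0 x²≈0

  *-cancelˡ-≤ : ∀ {x y z} → 0# < z → z * x ≤ z * y → x ≤ y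
  *-cancelˡ-≤ {x} {y} {z} (0≤z , 0≉z) zx≤zy with x ≤? y
  ... | yes x≤y = x≤y
  ... | no  x≰y = ≤-reflexive (begin
    x          ≈⟨ solve 2 (λ x y → x := y :+ (x :- y)) refl x y ⟩
    y + (x - y) ≈⟨ +-congˡ (*-zero-cancelˡ (λ z≈0 → 0≉z (sym z≈0)) z[x-y]≈0) ⟩
    y + 0#      ≈⟨ +-identityʳ y ⟩
    y           ∎)
    where
    z[x-y]≈0 : z * (x - y) ≈ 0#
    z[x-y]≈0 = begin
      z * (x - y)   ≈⟨ solve 3 (λ x y z → z :* (x :- y) := z :* x :- z :* y) refl x y z ⟩
      z * x - z * y ≈⟨ +-congʳ (antisym zx≤zy (*-monoˡ-≤ 0≤z (≰⇒≥ x≰y))) ⟩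
      z * y - z * y ≈⟨ -‿inverseʳ _ ⟩
      0#            ∎

  0<x⇒0<x⁻¹ : ∀ {x} → 0# < x → 0# < x ⁻¹
  0<x⇒0<x⁻¹ {x} 0<x@(0≤x , 0≉x) =
      *-cancelˡ-≤ 0<x (≤-respˡ-≈ (sym (zeroʳ x)) (≤-respʳ-≈ (sym xx⁻¹≈1) 0≤1))
    , λ 0≈x⁻¹ → 0≉1 (trans (sym (zeroʳ x)) (trans (*-congˡ 0≈x⁻¹) xx⁻¹≈1))
    where
    xx⁻¹≈1 : x * x ⁻¹ ≈ 1#
    xx⁻¹≈1 = *-inverseʳ x (λ x≈0 → 0≉x (sym x≈0))

  x≤y*z⇒x/z≤y : ∀ {x y z} → 0# < z → x ≤ y * z → x / z ≤ y
  x≤y*z⇒x/z≤y {x} {y} {z} 0<z@(_ , 0≉z) x≤yz = ≤-respˡ-≈ (*-comm (z ⁻¹) x)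
    (≤-respʳ-≈ (begin
      z ⁻¹ * (y * z)   ≈⟨ solve 3 (λ y z z⁻¹ → z⁻¹ :* (y :* z) := y :* (z :* z⁻¹)) refl y z (z ⁻¹) ⟩
      y * (z * z ⁻¹)   ≈⟨ *-congˡ (*-inverseʳ z (λ z≈0 → 0≉z (sym z≈0))) ⟩
      y * 1#           ≈⟨ *-identityʳ y ⟩
      y                ∎)
      (*-monoˡ-≤ (proj₁ (0<x⇒0<x⁻¹ 0<z)) x≤yz))

  *-positive : ∀ {x y} → 0# < x → 0# < y → 0# < x * y
  *-positive (0≤x , 0≉x) (0≤y , 0≉y) = *-nonNegative 0≤x 0≤y ,
    λ 0≈xy → 0≉y (sym (*-zero-cancelˡ (λ x≈0 → 0≉x (sym x≈0)) (sym 0≈xy)))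

-- Numerical inequalities behind the ratio bounds.

module Estimates (ℝ : CompleteOrderedField) where

  open OrderedField ℝ

  -- C is the new cost, Q the energy of the new flow, and H, G are ⟨h,h⟩, ⟨h,g⟩ as above.
  cost-bound : ∀ {C a b H G Q} qS xK → 0# ≤ a →
               a * Q + b * (qS - xK) ≤ C → C ≤ a * G + b * qS → G + G ≤ H + Q →
               C ≤ a * H + b * qS + b * xK
  cost-bound {C} {a} {b} {H} {G} {Q} qS xK 0≤a lower upper 2G≤H+Q = ≤-by _
    -- Twice the upper bound minus the lower one; `2G ≤ H + Q` then cancels the energy `Q` of the
    -- new flow.
    (+-nonNegative (+-nonNegative (x≤y⇒0≤y-x upper) (x≤y⇒0≤y-x upper))
      (+-nonNegative (x≤y⇒0≤y-x lower) (*-nonNegative 0≤a (x≤y⇒0≤y-x 2G≤H+Q))))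
    (solve 8 (λ C a b H G Q qS xK → a :* H :+ b :* qS :+ b :* xK :=
        C :+ (a :* G :+ b :* qS :- C :+ (a :* G :+ b :* qS :- C)
          :+ (C :- (a :* Q :+ b :* (qS :- xK)) :+ a :* (H :+ Q :- (G :+ G))))) refl
      C a b H G Q qS xK)

  -- Since r·xK ≤ xS ≤ qS, `r` copies of the saving fit into one further copy of `b * (q * S)`.
  saving-bound : ∀ {C a b H q S x K} r → 0# ≤ a → 0# ≤ b → 0# ≤ H → 0# ≤ S → 0# ≤ x → x ≤ q →
                 C ≤ a * H + b * (q * S) + b * (x * K) → nat r * K ≤ S →
                 nat r * C ≤ nat (suc r) * (a * H + b * (q * S))
  saving-bound {C} {a} {b} {H} {q} {S} {x} {K} r 0≤a 0≤b 0≤H 0≤S 0≤x x≤q C≤ rK≤S = ≤-by _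
    (+-nonNegative (+-nonNegative (*-nonNegative (0≤nat r) (x≤y⇒0≤y-x C≤)) (*-nonNegative 0≤a 0≤H))
      (*-nonNegative 0≤b (+-nonNegative (*-nonNegative 0≤x (x≤y⇒0≤y-x rK≤S))
        (*-nonNegative (x≤y⇒0≤y-x x≤q) 0≤S))))
    (trans (trans (distribʳ _ 1# (nat r)) (+-congʳ (*-identityˡ _)))
      (solve 9 (λ r C a b H q S x K → a :* H :+ b :* (q :* S) :+ r :* (a :* H :+ b :* (q :* S)) :=
          r :* C :+ (r :* (a :* H :+ b :* (q :* S) :+ b :* (x :* K) :- C) :+ a :* H
            :+ b :* (x :* (S :- r :* K) :+ (q :- x) :* S))) refl
        (nat r) C a b H q S x K))

  rise-bound : ∀ {C a b H G qS xR} r → 0# ≤ a → 0# ≤ b → 0# ≤ qS →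
               C ≤ a * G + b * qS → G ≈ H + xR → nat r * xR ≤ H →
               nat r * C ≤ nat (suc r) * (a * H + b * qS)
  rise-bound {C} {a} {b} {H} {G} {qS} {xR} r 0≤a 0≤b 0≤qS C≤ G≈ rxR≤H = ≤-by _
    (+-nonNegative (+-nonNegative
      (*-nonNegative (0≤nat r) (x≤y⇒0≤y-x (≤-respʳ-≈ (+-congʳ (*-congˡ G≈)) C≤)))
      (*-nonNegative 0≤a (x≤y⇒0≤y-x rxR≤H))) (*-nonNegative 0≤b 0≤qS))
    (trans (trans (distribʳ _ 1# (nat r)) (+-congʳ (*-identityˡ _)))
      (solve 7 (λ r C a b H qS xR → a :* H :+ b :* qS :+ r :* (a :* H :+ b :* qS) :=
          r :* C :+ (r :* (a :* (H :+ xR) :+ b :* qS :- C) :+ a :* (H :- r :* xR) :+ b :* qS)) refl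
        (nat r) C a b H qS xR))

  -- The chord saves at least (M + N)/4 steps, of which at most N are vertical; what remains exceeds
  -- M/8 once N is small against M.
  width-bound : ∀ {M N W K} → 0# ≤ N → K ≤ W + N → nat 8 * N ≤ M → M + N ≤ nat 4 * K → M ≤ nat 8 * W
  width-bound {M} {N} {W} {K} 0≤N K≤W+N 8N≤M S≤4K = ≤-by _
    (+-nonNegative (+-nonNegative (*-nonNegative (0≤nat 8) (x≤y⇒0≤y-x K≤W+N))
      (*-nonNegative (0≤nat 2) (x≤y⇒0≤y-x S≤4K)))
      (+-nonNegative (x≤y⇒0≤y-x 8N≤M) (*-nonNegative (0≤nat 2) 0≤N)))
    (solve 4 (λ M N W K → con (+ 8) :* W := M :+
        (con (+ 8) :* (W :+ N :- K) :+ con (+ 2) :* (con (+ 4) :* K :- (M :+ N))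
          :+ (M :- con (+ 8) :* N :+ con (+ 2) :* N))) refl M N W K)

  -- From MR ≤ 8WR ≤ 8qN follows 8NM·xR ≤ 64q²N² ≤ q²M² ≤ 2NM·H, and 2NM cancels. Thinness enters
  -- squared.
  energy-dominates : ∀ {M N W H q x R} → 0# < M → 0# < N → 0# ≤ q → x ≤ q → 0# ≤ R →
                     nat 8 * N ≤ M → M ≤ nat 8 * W → W * R ≤ q * N → q * q * M ≤ nat 2 * N * H →
                     nat 4 * (x * R) ≤ H
  energy-dominates {M} {N} {W} {H} {q} {x} {R} 0<M 0<N 0≤q x≤q 0≤R 8N≤M M≤8W WR≤qN q²M≤2NH =
    *-cancelˡ-≤ 0<M (*-cancelˡ-≤ 0<N (*-cancelˡ-≤ (0<nat 1) (≤-by _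
      (+-nonNegative (+-nonNegative
        (*-nonNegative (proj₁ 0<M) (x≤y⇒0≤y-x q²M≤2NH))
        (*-nonNegative (0≤x² q) (*-nonNegative (x≤y⇒0≤y-x 8N≤M)
          (+-nonNegative (proj₁ 0<M) (*-nonNegative (0≤nat 8) (proj₁ 0<N))))))
        (*-nonNegative (*-nonNegative (0≤nat 8) (proj₁ 0<N)) (+-nonNegative
          (*-nonNegative 0≤q (x≤y⇒0≤y-x MR≤8qN))
          (*-nonNegative (x≤y⇒0≤y-x x≤q) (*-nonNegative (proj₁ 0<M) 0≤R)))))
      (solve 6 (λ M N H q x R → con (+ 2) :* (N :* (M :* H)) :=
            con (+ 2) :* (N :* (M :* (con (+ 4) :* (x :* R)))) :+
          (M :* (con (+ 2) :* N :* H :- q :* q :* M) :+ q :* q :* ((M :- con (+ 8) :* N) :* (M :+ con (+ 8) :* N))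
            :+ con (+ 8) :* N :* (q :* (con (+ 8) :* (q :* N) :- M :* R) :+ (q :- x) :* (M :* R)))) refl
        M N H q x R))))
    where
    MR≤8qN : M * R ≤ nat 8 * (q * N)
    MR≤8qN = ≤-trans (≤-respˡ-≈ (*-comm R M) (≤-respʳ-≈
        (solve 3 (λ r e W → r :* (e :* W) := e :* (W :* r)) refl R (nat 8) W)
        (*-monoˡ-≤ 0≤R M≤8W)))
      (*-monoˡ-≤ (0≤nat 8) WR≤qN)

  quotient-bound : ∀ {x y C} r → 0# < y → nat (suc r) * x ≤ nat (suc (suc r)) * C → C ≤ y →
                   x / y ≤ nat (suc (suc r)) / nat (suc r)
  quotient-bound {x} {y} {C} r 0<y rx≤ C≤y = x≤y*z⇒x/z≤y 0<y (*-cancelˡ-≤ (0<nat r) (≤-trans rx≤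
    (≤-trans (*-monoˡ-≤ (0≤nat (suc (suc r))) C≤y) (≤-reflexive (sym (trans
      (solve 4 (λ l k k⁻¹ y → k :* (l :* k⁻¹ :* y) := l :* (k :* k⁻¹) :* y) refl _ k (k ⁻¹) y)
      (*-congʳ (trans (*-congˡ (*-inverseʳ k (λ k≈0 → proj₂ (0<nat r) (sym k≈0)))) (*-identityʳ _)))))))))
    where
    k = nat (suc r)

-- Finite sums and indicators.

module Sums (ℝ : CompleteOrderedField) where

  open OrderedField ℝ
  open import Relation.Binary.Reasoning.Setoid setoid

  module _ {A : Set} where

    ∑-cong : ∀ (xs : List A) {F G} → (∀ x → F x ≈ G x) → ∑ xs F ≈ ∑ xs G
    ∑-cong []       F≈G = refl
    ∑-cong (x ∷ xs) F≈G = +-cong (F≈G x) (∑-cong xs F≈G)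

    ∑-zero : ∀ (xs : List A) → ∑ xs (λ _ → 0#) ≈ 0#
    ∑-zero []       = refl
    ∑-zero (x ∷ xs) = trans (+-identityˡ _) (∑-zero xs)

    ∑-+ : ∀ (xs : List A) F G → ∑ xs (λ x → F x + G x) ≈ ∑ xs F + ∑ xs G
    ∑-+ []       F G = sym (+-identityˡ 0#)
    ∑-+ (x ∷ xs) F G = trans (+-congˡ (∑-+ xs F G))
      (solve 4 (λ a b c d → a :+ b :+ (c :+ d) := a :+ c :+ (b :+ d)) refl (F x) (G x) _ _)

    ∑-*ˡ : ∀ (xs : List A) c F → ∑ xs (λ x → c * F x) ≈ c * ∑ xs F
    ∑-*ˡ []       c F = sym (zeroʳ c)
    ∑-*ˡ (x ∷ xs) c F = trans (+-congˡ (∑-*ˡ xs c F)) (sym (distribˡ c _ _))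

    ∑-*ʳ : ∀ (xs : List A) F c → ∑ xs (λ x → F x * c) ≈ ∑ xs F * c
    ∑-*ʳ xs F c = trans (∑-cong xs (λ x → *-comm (F x) c)) (trans (∑-*ˡ xs c F) (*-comm c _))

    ∑-- : ∀ (xs : List A) F G → ∑ xs (λ x → F x - G x) ≈ ∑ xs F - ∑ xs G
    ∑-- []       F G = sym (-‿inverseʳ 0#)
    ∑-- (x ∷ xs) F G = trans (+-congˡ (∑-- xs F G))
      (solve 4 (λ a b c d → a :- b :+ (c :- d) := a :+ c :- (b :+ d)) refl (F x) (G x) _ _)

    ∑-mono-All : ∀ {xs : List A} {F G} → All (λ x → F x ≤ G x) xs → ∑ xs F ≤ ∑ xs G
    ∑-mono-All []             = ≤-refl
    ∑-mono-All (Fx≤Gx ∷ F≤G) = +-mono-≤ Fx≤Gx (∑-mono-All F≤G)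

    ∑-mono : ∀ (xs : List A) {F G} → (∀ x → F x ≤ G x) → ∑ xs F ≤ ∑ xs G
    ∑-mono xs F≤G = ∑-mono-All (All.universal F≤G xs)

    ∑-nonNegative : ∀ (xs : List A) {F} → (∀ x → 0# ≤ F x) → 0# ≤ ∑ xs F
    ∑-nonNegative xs 0≤F = ≤-respˡ-≈ (∑-zero xs) (∑-mono xs 0≤F)

    ∑≈0⇒≈0 : ∀ {xs : List A} {F} → (∀ x → 0# ≤ F x) → ∑ xs F ≤ 0# → ∀ {x} → x ∈ xs → F x ≈ 0#
    ∑≈0⇒≈0 {x ∷ xs} {F} 0≤F ∑≤0 (here ≡.refl) =
      antisym (≤-trans (≤-by (∑ xs F) (∑-nonNegative xs 0≤F) refl) ∑≤0) (0≤F x)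
    ∑≈0⇒≈0 {x ∷ xs} {F} 0≤F ∑≤0 (there y∈xs) =
      ∑≈0⇒≈0 0≤F (≤-trans (≤-by (F x) (0≤F x) (+-comm _ _)) ∑≤0) y∈xs

    ∑-++ : ∀ (xs ys : List A) F → ∑ (xs ++ ys) F ≈ ∑ xs F + ∑ ys F
    ∑-++ []       ys F = sym (+-identityˡ _)
    ∑-++ (x ∷ xs) ys F = trans (+-congˡ (∑-++ xs ys F)) (sym (+-assoc _ _ _))

    ∑-map : ∀ {B : Set} (g : A → B) (xs : List A) F → ∑ (map g xs) F ≈ ∑ xs (F ∘ g)
    ∑-map g []       F = refl
    ∑-map g (x ∷ xs) F = +-congˡ (∑-map g xs F)

  module _ {A : Set} where

    ∑-swap : ∀ {B : Set} (xs : List A) (ys : List B) (F : A → B → Carrier) →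
             ∑ xs (λ x → ∑ ys (F x)) ≈ ∑ ys (λ y → ∑ xs (λ x → F x y))
    ∑-swap []       ys F = sym (∑-zero ys)
    ∑-swap (x ∷ xs) ys F = trans (+-congˡ (∑-swap xs ys F)) (sym (∑-+ ys (F x) _))

    ∑-cartesianProduct : ∀ {B : Set} (xs : List A) (ys : List B) F →
                         ∑ (cartesianProduct xs ys) F ≈ ∑ xs (λ x → ∑ ys (λ y → F (x , y)))
    ∑-cartesianProduct []       ys F = refl
    ∑-cartesianProduct (x ∷ xs) ys F = trans (∑-++ (map (x ,_) ys) _ F)
      (+-cong (reflexive (≡.cong (foldr _+_ 0#) (≡.sym (List.map-∘ ys))))
              (∑-cartesianProduct xs ys F))

    ∑-↭ : ∀ {xs ys : List A} → xs ↭ ys → ∀ F → ∑ xs F ≈ ∑ ys F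
    ∑-↭ Perm.refl F         = refl
    ∑-↭ (Perm.prep x p) F   = +-congˡ (∑-↭ p F)
    ∑-↭ (Perm.swap x y p) F = trans (+-congˡ (+-congˡ (∑-↭ p F)))
      (solve 3 (λ a b c → a :+ (b :+ c) := b :+ (a :+ c)) refl (F x) (F y) _)
    ∑-↭ (Perm.trans p q) F  = trans (∑-↭ p F) (∑-↭ q F)

  -- Going through `does` makes the indicators of `suc i < suc k` and `i < k` definitionally equal,
  -- on which the induction in `∑-allFin-<` relies.
  𝟙 : ∀ {P : Set} → Dec P → Carrier
  𝟙 P? = if does P? then 1# else 0#

  0≤𝟙 : ∀ {P : Set} (P? : Dec P) → 0# ≤ 𝟙 P?
  0≤𝟙 (yes _) = 0≤1
  0≤𝟙 (no _)  = ≤-refl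

  𝟙-yes : ∀ {P : Set} (P? : Dec P) → P → 𝟙 P? ≈ 1#
  𝟙-yes (yes _) _ = refl
  𝟙-yes (no ¬p) p = ⊥-elim (¬p p)

  𝟙-no : ∀ {P : Set} (P? : Dec P) → ¬ P → 𝟙 P? ≈ 0#
  𝟙-no (yes p) ¬p = ⊥-elim (¬p p)
  𝟙-no (no _)  _  = refl

  module _ {A : Set} where

    ∑-filter : ∀ {P : Pred A _} (P? : Decidable P) xs F →
               ∑ (filter P? xs) F ≈ ∑ xs (λ x → 𝟙 (P? x) * F x)
    ∑-filter P? []       F = refl
    ∑-filter P? (x ∷ xs) F with P? x
    ... | yes _ = +-cong (sym (*-identityˡ _)) (∑-filter P? xs F)
    ... | no  _ = trans (∑-filter P? xs F) (trans (sym (+-identityˡ _)) (+-congʳ (sym (zeroˡ _))))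

    -- Duplicate-free lists with the same members are permutations of each other, so the order of
    -- enumeration is immaterial.
    ∑-select : ∀ {P : Pred A _} (P? : Decidable P) {xs ys} → Unique xs → Unique ys →
               (∀ x → (x ∈ xs × P x) ⇔ x ∈ ys) → ∀ F →
               ∑ xs (λ x → 𝟙 (P? x) * F x) ≈ ∑ ys F
    ∑-select P? {xs} {ys} xs! ys! P⇔∈ F = trans (sym (∑-filter P? xs F))
      (∑-↭ (∼bag⇒↭ (unique∧set⇒bag (Unique.filter⁺ P? xs!) ys! λ {x} → mk⇔
        (λ x∈ → Equivalence.to (P⇔∈ x) (∈-filter⁻ P? x∈))
        (λ x∈ → let y∈xs , Py = Equivalence.from (P⇔∈ x) x∈ in ∈-filter⁺ P? y∈xs Py))) F)

    ∑-δ : ∀ (_≟ᴬ_ : DecidableEquality A) {xs} → Unique xs → ∀ {y} → y ∈ xs → ∀ F →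
          ∑ xs (λ x → 𝟙 (x ≟ᴬ y) * F x) ≈ F y
    ∑-δ _≟ᴬ_ xs! {y} y∈xs F = trans
      (∑-select (_≟ᴬ y) xs! ([] ∷ []) (λ x → mk⇔
        (λ { (_ , ≡.refl) → here ≡.refl }) (λ { (here ≡.refl) → y∈xs , ≡.refl })) F)
      (+-identityʳ _)

  ∑-tabulate : ∀ {A : Set} {n} (g : Fin n → A) F → ∑ (tabulate g) F ≡ ∑ (allFin n) (F ∘ g)
  ∑-tabulate g F = ≡.cong (foldr _+_ 0#)
    (≡.trans (List.map-tabulate g F) (≡.sym (List.map-tabulate id (F ∘ g))))

  ∑-allFin-suc : ∀ n F → ∑ (allFin (suc n)) F ≈ F Fin.zero + ∑ (allFin n) (F ∘ Fin.suc)
  ∑-allFin-suc n F = +-congˡ (reflexive (∑-tabulate Fin.suc F))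

  ∑-allFin-telescope : ∀ n (F : Fin (suc n) → Carrier) →
                       ∑ (allFin n) (λ i → F (inject₁ i) - F (Fin.suc i)) ≈ F Fin.zero - F (fromℕ n)
  ∑-allFin-telescope zero    F = sym (-‿inverseʳ _)
  ∑-allFin-telescope (suc n) F = trans (∑-allFin-suc n (λ i → F (inject₁ i) - F (Fin.suc i)))
    (trans (+-congˡ (∑-allFin-telescope n (F ∘ Fin.suc)))
      (solve 3 (λ a b c → a :- b :+ (b :- c) := a :- c) refl (F Fin.zero) _ _))

  ∑-allFin-const : ∀ n c → ∑ (allFin n) (λ _ → c) ≈ nat n * c
  ∑-allFin-const zero    c = sym (zeroˡ c)
  ∑-allFin-const (suc n) c = trans (∑-allFin-suc n (λ _ → c)) (trans (+-congˡ (∑-allFin-const n c))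
    (trans (+-congʳ (sym (*-identityˡ c))) (sym (distribʳ c 1# (nat n)))))

  ∑-allFin-< : ∀ {k n} → k ℕ.≤ n → ∑ (allFin n) (λ i → 𝟙 (toℕ i ℕ.<? k)) ≈ nat k
  ∑-allFin-< {n = n} ℕ.z≤n = ∑-zero (allFin n)
  ∑-allFin-< {suc k} {suc n} (ℕ.s≤s k≤n) = trans (∑-allFin-suc n (λ i → 𝟙 (toℕ i ℕ.<? suc k)))
    (+-congˡ (∑-allFin-< k≤n))

  ∑-allFin-δ : ∀ {n} (i : Fin n) F → ∑ (allFin n) (λ j → 𝟙 (j Fin.≟ i) * F j) ≈ F i
  ∑-allFin-δ {n} i = ∑-δ Fin._≟_ (Unique.allFin⁺ n) (∈-allFin i)

-- Gradients on a network and projection onto them.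

module Potentials (ℝ : CompleteOrderedField) (N : Network) where

  open OrderedField ℝ
  open Sums ℝ
  open Network N
  open import Relation.Binary.Reasoning.Setoid setoid

  drop : (Vertex → Carrier) → Arc → Carrier
  drop θ e = θ (src e) - θ (tgt e)

  infix 9 ⟪_,_⟫
  ⟪_,_⟫ : (Arc → Carrier) → (Arc → Carrier) → Carrier
  ⟪ X , Y ⟫ = ∑ arcs (λ e → X e * Y e)

  ⟪⟫-comm : ∀ X Y → ⟪ X , Y ⟫ ≈ ⟪ Y , X ⟫
  ⟪⟫-comm X Y = ∑-cong arcs (λ e → *-comm (X e) (Y e))

  ∑-drop-walk : ∀ {u v} (p : Walk u v) θ → ∑ (walkArcs p) (drop θ) ≈ θ u - θ v
  ∑-drop-walk ε θ = sym (-‿inverseʳ _)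
  ∑-drop-walk ((e , ≡.refl , ≡.refl) ◅ p) θ = trans (+-congˡ (∑-drop-walk p θ))
    (solve 3 (λ a b c → a :- b :+ (b :- c) := a :- c) refl (θ (src e)) _ _)

  src∈walkVertices : ∀ {u v} (p : Walk u v) {e} → e ∈ walkArcs p → src e ∈ walkVertices p
  src∈walkVertices ((e , ≡.refl , ≡.refl) ◅ p) (here ≡.refl) = here ≡.refl
  src∈walkVertices (_ ◅ p)                     (there e∈)    = there (src∈walkVertices p e∈)

  -- A repeated arc would repeat its source. This reconciles the membership test in a path
  -- decomposition, which counts an arc once, with sums along the path.
  walkArcs! : ∀ {u v} (p : Walk u v) → Unique (walkVertices p) → Unique (walkArcs p)
  walkArcs! ε _ = []
  walkArcs! ((e , ≡.refl , ≡.refl) ◅ p) (e∉p ∷ p!) =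
    All.tabulate (λ { e∈ ≡.refl → All.lookup e∉p (src∈walkVertices p e∈) ≡.refl }) ∷ walkArcs! p p!

  -- `spanned` places the gradient of `potential` in the span of the gradients of `cs`. The dual
  -- form avoids carrying coefficients through the recursion.
  record Projection (cs : List (Vertex → Carrier)) (X : Arc → Carrier) : Set where
    field
      potential  : Vertex → Carrier
      orthogonal : All (λ c → ⟪ (λ e → X e - drop potential e) , drop c ⟫ ≈ 0#) cs
      spanned    : ∀ Y → All (λ c → ⟪ Y , drop c ⟫ ≈ 0#) cs → ⟪ Y , drop potential ⟫ ≈ 0#

  -- Gram–Schmidt.
  project : ∀ cs X → Projection cs X
  project [] X = record
    { potential  = λ _ → 0#
    ; orthogonal = []
    ; spanned    = λ Y _ → trans (∑-cong arcs (λ e → solve 1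
                     (λ y → y :* (con (+ 0) :- con (+ 0)) := con (+ 0)) refl (Y e))) (∑-zero arcs)
    }
  project (c ∷ cs) X with project cs X | project cs (drop c)
  ... | record { potential = φ ; orthogonal = X-φ⊥cs ; spanned = φ∈cs }
      | record { potential = χ ; orthogonal = c-χ⊥cs ; spanned = χ∈cs } = result
    where
    -- On drops, `c′` is `c` minus its projection onto the span of `cs`.
    c′ : Vertex → Carrier
    c′ v = c v - χ v

    drop-c′ : ∀ e → drop c′ e ≈ drop c e - drop χ e
    drop-c′ e = solve 4 (λ a b a′ b′ → a :- a′ :- (b :- b′) := a :- b :- (a′ :- b′)) refl
      (c (src e)) (c (tgt e)) (χ (src e)) (χ (tgt e))

    c-split : ∀ Y → ⟪ Y , drop c ⟫ ≈ ⟪ Y , drop c′ ⟫ + ⟪ Y , drop χ ⟫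
    c-split Y = trans
      (∑-cong arcs (λ e → trans
        (solve 3 (λ y a b → y :* a := y :* (a :- b) :+ y :* b) refl (Y e) (drop c e) (drop χ e))
        (+-congʳ (*-congˡ (sym (drop-c′ e))))))
      (∑-+ arcs _ _)

    c′⊥cs : All (λ w → ⟪ drop c′ , drop w ⟫ ≈ 0#) cs
    c′⊥cs = All.map (λ {w} p → trans (∑-cong arcs (λ e → *-congʳ {drop w e} (drop-c′ e))) p) c-χ⊥cs

    norm² : Carrier
    norm² = ⟪ drop c′ , drop c′ ⟫

    Y-c′ : ∀ Y → All (λ w → ⟪ Y , drop w ⟫ ≈ 0#) (c ∷ cs) → ⟪ Y , drop c′ ⟫ ≈ 0#
    Y-c′ Y (Y⊥c ∷ Y⊥cs) = trans (trans (sym (+-identityʳ _)) (+-congˡ (sym (χ∈cs Y Y⊥cs))))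
      (trans (sym (c-split Y)) Y⊥c)

    result : Projection (c ∷ cs) X
    result with norm² ≟ 0#
    -- The gradient of `c` already lies in the span of the earlier ones: `drop c′` vanishes on every
    -- arc, and `φ` stays as it is.
    ... | yes norm²≈0 = record
      { potential  = φ
      ; orthogonal = trans (c-split _) (trans (+-cong
            (trans (∑-cong arcs (λ e → trans (*-congˡ (c′≈0 e)) (zeroʳ _))) (∑-zero arcs))
            (χ∈cs _ X-φ⊥cs)) (+-identityˡ 0#)) ∷ X-φ⊥cs
      ; spanned    = λ { Y (_ ∷ Y⊥cs) → φ∈cs Y Y⊥cs }
      }
      where
      c′≈0 : ∀ e → drop c′ e ≈ 0#
      c′≈0 e = x²≈0⇒x≈0 (∑≈0⇒≈0 (λ e → 0≤x² (drop c′ e)) (≤-reflexive norm²≈0) (complete e))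
    ... | no norm²≉0 = record
      { potential  = φ⁺
      ; orthogonal = trans (c-split _) (trans (+-cong X-φ⁺⊥c′ (χ∈cs _ X-φ⁺⊥cs)) (+-identityˡ 0#))
                   ∷ X-φ⁺⊥cs
      ; spanned    = λ { Y Y⊥@(_ ∷ Y⊥cs) → trans (φ⁺-split Y) (trans
                       (+-cong (φ∈cs Y Y⊥cs) (trans (*-congˡ (Y-c′ Y Y⊥)) (zeroʳ β)))
                       (+-identityˡ 0#)) }
      }
      where
      β : Carrier
      β = ⟪ (λ e → X e - drop φ e) , drop c′ ⟫ / norm²

      φ⁺ : Vertex → Carrier
      φ⁺ v = φ v + β * c′ v

      drop-φ⁺ : ∀ e → drop φ⁺ e ≈ drop φ e + β * drop c′ e
      drop-φ⁺ e = solve 5 (λ a b k a′ b′ → a :+ k :* a′ :- (b :+ k :* b′) := a :- b :+ k :* (a′ :- b′))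
        refl (φ (src e)) (φ (tgt e)) β (c′ (src e)) (c′ (tgt e))

      φ⁺-split : ∀ Y → ⟪ Y , drop φ⁺ ⟫ ≈ ⟪ Y , drop φ ⟫ + β * ⟪ Y , drop c′ ⟫
      φ⁺-split Y = trans
        (∑-cong arcs (λ e → trans (*-congˡ (drop-φ⁺ e)) (solve 4
          (λ y a k b → y :* (a :+ k :* b) := y :* a :+ k :* (y :* b)) refl (Y e) _ β _)))
        (trans (∑-+ arcs _ _) (+-congˡ (∑-*ˡ arcs β _)))

      residual : ∀ w → ⟪ (λ e → X e - drop φ⁺ e) , drop w ⟫
                     ≈ ⟪ (λ e → X e - drop φ e) , drop w ⟫ - β * ⟪ drop c′ , drop w ⟫
      residual w = trans
        (∑-cong arcs (λ e → trans (*-congʳ (+-congˡ (-‿cong (drop-φ⁺ e)))) (solve 5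
          (λ x a k b y → (x :- (a :+ k :* b)) :* y := (x :- a) :* y :- k :* (b :* y)) refl
          (X e) (drop φ e) β (drop c′ e) (drop w e))))
        (trans (∑-- arcs _ _) (+-congˡ (-‿cong (∑-*ˡ arcs β _))))

      X-φ⁺⊥c′ : ⟪ (λ e → X e - drop φ⁺ e) , drop c′ ⟫ ≈ 0#
      X-φ⁺⊥c′ = begin
        ⟪ (λ e → X e - drop φ⁺ e) , drop c′ ⟫ ≈⟨ residual c′ ⟩
        Z - Z * norm² ⁻¹ * norm²              ≈⟨ solve 3 (λ z n n⁻¹ → z :- z :* n⁻¹ :* n :=
              z :- z :* (n :* n⁻¹)) refl Z norm² (norm² ⁻¹) ⟩
        Z - Z * (norm² * norm² ⁻¹)            ≈⟨ +-congˡ (-‿cong (trans (*-congˡ (*-inverseʳ _ norm²≉0)) (*-identityʳ Z))) ⟩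
        Z - Z                                 ≈⟨ -‿inverseʳ Z ⟩
        0#                                    ∎
        where Z = ⟪ (λ e → X e - drop φ e) , drop c′ ⟫

      X-φ⁺⊥cs : All (λ w → ⟪ (λ e → X e - drop φ⁺ e) , drop w ⟫ ≈ 0#) cs
      X-φ⁺⊥cs = All.zipWith (λ {w} (p , p′) → trans (residual w) (trans
        (+-cong p (-‿cong (trans (*-congˡ p′) (zeroʳ β)))) (-‿inverseʳ 0#))) (X-φ⊥cs , c′⊥cs)

  module _ {vs : List Vertex} (vs! : Unique vs) (vs-complete : ∀ v → v ∈ vs) where

    vertexIndicator : Vertex → Vertex → Carrier
    vertexIndicator v w = 𝟙 (v ≟ⱽ w)

    -- Every θ is ∑ᵥ θ(v)·1ᵥ.
    ⟪⟫-drop-indicators : ∀ Y θ → ⟪ Y , drop θ ⟫ ≈ ∑ vs (λ v → θ v * ⟪ Y , drop (vertexIndicator v) ⟫)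
    ⟪⟫-drop-indicators Y θ = begin
      ∑ arcs (λ e → Y e * drop θ e)
        ≈⟨ ∑-cong arcs (λ e → *-congˡ (+-cong (expand (src e)) (-‿cong (expand (tgt e))))) ⟩
      ∑ arcs (λ e → Y e * (∑ vs (λ v → δ v (src e) * θ v) - ∑ vs (λ v → δ v (tgt e) * θ v)))
        ≈⟨ ∑-cong arcs (λ e → trans (*-congˡ (sym (∑-- vs _ _))) (trans (sym (∑-*ˡ vs (Y e) _))
             (∑-cong vs (λ v → solve 4 (λ y a b t → y :* (a :* t :- b :* t) := t :* (y :* (a :- b)))
               refl (Y e) (δ v (src e)) (δ v (tgt e)) (θ v))))) ⟩
      ∑ arcs (λ e → ∑ vs (λ v → θ v * (Y e * drop (δ v) e)))
        ≈⟨ ∑-swap arcs vs _ ⟩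
      ∑ vs (λ v → ∑ arcs (λ e → θ v * (Y e * drop (δ v) e)))
        ≈⟨ ∑-cong vs (λ v → ∑-*ˡ arcs (θ v) _) ⟩
      ∑ vs (λ v → θ v * ⟪ Y , drop (δ v) ⟫) ∎
      where
      δ = vertexIndicator
      expand : ∀ w → θ w ≈ ∑ vs (λ v → δ v w * θ v)
      expand w = sym (∑-δ _≟ⱽ_ vs! (vs-complete w) θ)

    -- The discrete Poisson equation in weak form, solved by projecting `X` onto all gradients.
    -- Orthogonality to the gradients of vertex indicators extends to every `θ` by linearity.
    ∃-potential : ∀ X → ∃ λ φ → ∀ θ → ⟪ drop φ , drop θ ⟫ ≈ ⟪ X , drop θ ⟫
    ∃-potential X = φ , λ θ → begin
      ⟪ drop φ , drop θ ⟫
        ≈⟨ trans (∑-cong arcs (λ e → solve 3 (λ x p t → p :* t := x :* t :- (x :- p) :* t) refl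
             (X e) (drop φ e) (drop θ e))) (∑-- arcs _ _) ⟩
      ⟪ X , drop θ ⟫ - ⟪ (λ e → X e - drop φ e) , drop θ ⟫
        ≈⟨ +-congˡ (-‿cong (⟂ θ)) ⟩
      ⟪ X , drop θ ⟫ - 0#
        ≈⟨ trans (+-congˡ -0#≈0#) (+-identityʳ _) ⟩
      ⟪ X , drop θ ⟫ ∎
      where
      open Projection (project (map vertexIndicator vs) X) renaming (potential to φ)
      ⟂ : ∀ θ → ⟪ (λ e → X e - drop φ e) , drop θ ⟫ ≈ 0#
      ⟂ θ = trans (⟪⟫-drop-indicators _ θ) (trans (∑-cong vs (λ v → trans
        (*-congˡ (All.lookup orthogonal (∈-map⁺ vertexIndicator (vs-complete v)))) (zeroʳ (θ v))))
        (∑-zero vs))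

-- Consequences of user equilibrium.

module Equilibrium
  (ℝ : CompleteOrderedField) (N : Network)
  (ℓ : Network.Arc N → CompleteOrderedField.Carrier ℝ → CompleteOrderedField.Carrier ℝ)
  {q f} (s≢t : Network.s N ≢ Network.t N) (equilibriumFlow : Flows.UserEquilibrium ℝ N ℓ q f) where

  open OrderedField ℝ
  open Sums ℝ
  open Network N
  open Potentials ℝ N
  open Flows ℝ N ℓ
  open UserEquilibrium equilibriumFlow
  open import Relation.Binary.Reasoning.Setoid setoid

  ⟪flow,⟫ : ∀ w → ⟪ f , w ⟫ ≈ ∑ pathFlow (λ (p , x) → x * ∑ (pathArcs p) w)
  ⟪flow,⟫ w = begin
    ∑ arcs (λ e → f e * w e)
      ≈⟨ ∑-cong arcs (λ e → trans (*-congʳ (trans (decomposition e)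
           (∑-filter (λ (p , _) → e ∈? pathArcs p) pathFlow proj₂))) (sym (∑-*ʳ pathFlow _ (w e)))) ⟩
    ∑ arcs (λ e → ∑ pathFlow (λ (p , x) → 𝟙 (e ∈? pathArcs p) * x * w e))
      ≈⟨ ∑-swap arcs pathFlow _ ⟩
    ∑ pathFlow (λ (p , x) → ∑ arcs (λ e → 𝟙 (e ∈? pathArcs p) * x * w e))
      ≈⟨ ∑-cong pathFlow (λ (p , x) → trans
           (∑-cong arcs (λ e → solve 3 (λ i x w → i :* x :* w := x :* (i :* w)) refl
             (𝟙 (e ∈? pathArcs p)) x (w e)))
           (trans (∑-*ˡ arcs x _) (*-congˡ (∑-select (_∈? pathArcs p) unique (walkArcs! (proj₁ p) (proj₂ p))
             (λ e → mk⇔ proj₂ (λ e∈p → complete e , e∈p)) w)))) ⟩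
    ∑ pathFlow (λ (p , x) → x * ∑ (pathArcs p) w) ∎

  -- Pairing the flow with the gradient of the indicator of `s` evaluates in two ways: along each
  -- path it telescopes to 1, and arc by arc it is the net outflow at `s`.
  totalFlow : ∑ pathFlow proj₂ ≈ q
  totalFlow = begin
    ∑ pathFlow proj₂
      ≈⟨ ∑-cong pathFlow (λ (p , x) → trans (sym (*-identityʳ x)) (*-congˡ (sym (trans
           (∑-drop-walk (proj₁ p) δₛ) (trans (+-cong (𝟙-yes (s ≟ⱽ s) ≡.refl)
             (trans (-‿cong (𝟙-no (t ≟ⱽ s) (λ t≡s → s≢t (≡.sym t≡s)))) -0#≈0#)) (+-identityʳ 1#)))))) ⟩
    ∑ pathFlow (λ (p , x) → x * ∑ (pathArcs p) (drop δₛ))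
      ≈⟨ ⟪flow,⟫ (drop δₛ) ⟨
    ∑ arcs (λ e → f e * drop δₛ e)
      ≈⟨ ∑-cong arcs (λ e → solve 3 (λ f a b → f :* (a :- b) := a :* f :- b :* f) refl (f e) _ _) ⟩
    ∑ arcs (λ e → 𝟙 (src e ≟ⱽ s) * f e - 𝟙 (tgt e ≟ⱽ s) * f e)
      ≈⟨ ∑-- arcs _ _ ⟩
    ∑ arcs (λ e → 𝟙 (src e ≟ⱽ s) * f e) - ∑ arcs (λ e → 𝟙 (tgt e ≟ⱽ s) * f e)
      ≈⟨ +-cong (∑-filter (λ e → src e ≟ⱽ s) arcs f) (-‿cong (∑-filter (λ e → tgt e ≟ⱽ s) arcs f)) ⟨
    outflow f s - inflow f s
      ≈⟨ Feasible.source feasible ⟩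
    q ∎
    where
    δₛ : Vertex → Carrier
    δₛ v = 𝟙 (v ≟ⱽ s)

  -- Weak conservation: `θ` telescopes along each path of the decomposition.
  ⟪flow,drop⟫ : ∀ θ → ⟪ f , drop θ ⟫ ≈ q * (θ s - θ t)
  ⟪flow,drop⟫ θ = trans (⟪flow,⟫ (drop θ)) (trans
    (∑-cong pathFlow (λ (p , x) → *-congˡ (∑-drop-walk (proj₁ p) θ)))
    (trans (∑-*ʳ pathFlow proj₂ _) (*-congʳ totalFlow)))

  flow≤demand : ∀ e → f e ≤ q
  flow≤demand e = ≤-respˡ-≈ (sym (trans (decomposition e) (∑-filter _ pathFlow proj₂)))
    (≤-respʳ-≈ totalFlow (∑-mono-All (All.map (λ {(p , x)} 0≤x → 𝟙*≤ (e ∈? pathArcs p) 0≤x) nonNegative)))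
    where
    𝟙*≤ : ∀ {P : Set} (P? : Dec P) {x} → 0# ≤ x → 𝟙 P? * x ≤ x
    𝟙*≤ (yes _) {x} 0≤x = ≤-reflexive (*-identityˡ x)
    𝟙*≤ (no _)  {x} 0≤x = ≤-respˡ-≈ (sym (zeroˡ x)) 0≤x

  -- Each path carrying flow is no slower than `p`, and the carried amounts add up to `q`.
  cost≤demand*latency : ∀ p → cost f ≤ q * latency f p
  cost≤demand*latency p = ≤-respˡ-≈ (sym (⟪flow,⟫ (λ e → ℓ e (f e))))
    (≤-respʳ-≈ (trans (∑-*ʳ pathFlow proj₂ _) (*-congʳ totalFlow))
      (∑-mono-All (All.zipWith (λ { {(p′ , x)} (0≤x , optimal) → carried p′ 0≤x optimal })
        (nonNegative , equilibrium))))
    where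
    carried : ∀ p′ {x} → 0# ≤ x → (0# < x → ∀ p″ → latency f p′ ≤ latency f p″) →
              x * latency f p′ ≤ x * latency f p
    carried p′ {x} 0≤x optimal with 0# ≟ x
    ... | yes 0≈x = ≤-reflexive (trans (*-congʳ (sym 0≈x)) (trans (zeroˡ _) (trans (sym (zeroˡ _)) (*-congʳ 0≈x))))
    ... | no  0≉x = *-monoˡ-≤ 0≤x (optimal (0≤x , 0≉x) p)

-- Shortest distances to the sink along levelled edges.

module ShortestWalk
  (ℝ : CompleteOrderedField) (N : Network) (w : Network.Arc N → CompleteOrderedField.Carrier ℝ)
  {Edge : Set} {edges : List Edge} (edges-complete : ∀ e → e ∈ edges) (arc : Edge → Network.Arc N)
  (level : Network.Vertex N → ℕ)
  (level-src : ∀ e → level (Network.src N (arc e)) ≡ suc (level (Network.tgt N (arc e))))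
  (level-zero : ∀ v → level v ≡ 0 → v ≡ Network.t N)
  (exit : Network.Vertex N → Edge)
  (src-exit : ∀ {k} v → level v ≡ suc k → Network.src N (arc (exit v)) ≡ v)
  where

  open Network N
  open OrderedField ℝ
  open Sums ℝ
  open Extrema totalOrder using (argmin; f[argmin]≤f[xs]; argmin-all)

  leaving : Vertex → List Edge
  leaving v = filter (λ e → src (arc e) ≟ⱽ v) edges

  mutual

    -- Dynamic programming with the level as fuel: each edge lowers the level by exactly one, and at
    -- level zero the vertex is `t`, at distance `0#`.
    distanceIn : ℕ → Vertex → Carrier
    distanceIn zero    v = 0#
    distanceIn (suc k) v = via k (next k v)

    via : ℕ → Edge → Carrier
    via k e = w (arc e) + distanceIn k (tgt (arc e))

    next : ℕ → Vertex → Edge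
    -- `argmin` needs a default; away from `t`, `exit v` itself leaves `v`, so the minimiser does
    -- too.
    next k v = argmin (via k) (exit v) (leaving v)

  src-next : ∀ {k} v → level v ≡ suc k → src (arc (next k v)) ≡ v
  src-next {k} v eq = argmin-all (via k) (src-exit v eq)
    (All.tabulate (λ e∈ → proj₂ (∈-filter⁻ (λ e → src (arc e) ≟ⱽ v) {xs = edges} e∈)))

  level-next : ∀ {k} v → level v ≡ suc k → level (tgt (arc (next k v))) ≡ k
  level-next {k} v eq = ℕ.suc-injective
    (≡.trans (≡.sym (level-src (next k v))) (≡.trans (≡.cong level (src-next v eq)) eq))

  shortest : ∀ k v → level v ≡ k → Walk v t
  shortest zero    v eq with ≡.refl ← level-zero v eq = ε
  shortest (suc k) v eq = (arc (next k v) , src-next v eq , ≡.refl) ◅ shortest k _ (level-next v eq)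

  shortest-length : ∀ k v eq → ∑ (walkArcs (shortest k v eq)) w ≈ distanceIn k v
  shortest-length zero    v eq with ≡.refl ← level-zero v eq = refl
  shortest-length (suc k) v eq = +-congˡ (shortest-length k _ (level-next v eq))

  shortest-levels : ∀ k v eq → All (λ u → level u ℕ.≤ k) (walkVertices (shortest k v eq))
  shortest-levels zero    v eq with ≡.refl ← level-zero v eq = ℕ.≤-reflexive eq ∷ []
  shortest-levels (suc k) v eq =
    ℕ.≤-reflexive eq ∷ All.map ℕ.m≤n⇒m≤1+n (shortest-levels k _ (level-next v eq))

  -- Levels strictly decrease along the walk, so no vertex recurs.
  shortest! : ∀ k v eq → Unique (walkVertices (shortest k v eq))
  shortest! zero    v eq with ≡.refl ← level-zero v eq = [] ∷ []
  shortest! (suc k) v eq =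
      All.map (λ { u≤k ≡.refl → ℕ.<⇒≱ (ℕ.n<1+n k) (≡.subst (ℕ._≤ k) eq u≤k) })
              (shortest-levels k _ (level-next v eq))
    ∷ shortest! k _ (level-next v eq)

  distance : Vertex → Carrier
  distance v = distanceIn (level v) v

  shortestPath : Path
  shortestPath = shortest (level s) s ≡.refl , shortest! (level s) s ≡.refl

  -- The subsolution property, immediate from the minimum over edges leaving the source; rewriting
  -- by `level-src` exposes the successor that unfolds `distance`.
  distance-src : ∀ e → distance (src (arc e)) ≤ w (arc e) + distance (tgt (arc e))
  distance-src e rewrite level-src e =
    All.lookup (f[argmin]≤f[xs] {f = via (level (tgt (arc e)))} (exit (src (arc e))) (leaving (src (arc e))))
      (∈-filter⁺ (λ e′ → src (arc e′) ≟ⱽ src (arc e)) (edges-complete e) ≡.refl)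

-- Minimum principle for currents of an electrical flow.

inject₁≢suc : ∀ {n} (i : Fin n) → inject₁ i ≢ Fin.suc i
inject₁≢suc i eq = ℕ.m≢1+m+n (toℕ i)
  (≡.trans (≡.sym (Fin.toℕ-inject₁ i)) (≡.trans (≡.cong toℕ eq) (≡.cong suc (≡.sym (ℕ.+-identityʳ _)))))

module Monotonicity
  (ℝ : CompleteOrderedField) {q} (0≤q : CompleteOrderedField._≤_ ℝ (CompleteOrderedField.0# ℝ) q) where

  open OrderedField ℝ
  open Sums ℝ
  open Extrema totalOrder using (argmin; f[argmin]≤f[xs])
  open import Relation.Binary.Reasoning.Setoid setoid

  -- The equation div ∇φ = q(1ₛ − 1ₜ) on the m × n grid, tested against the products α ⊗ γ.
  IsElectrical : ∀ m n → (Fin (suc m) → Fin (suc n) → Carrier) → Set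
  IsElectrical m n φ = ∀ (α : Fin (suc m) → Carrier) (γ : Fin (suc n) → Carrier) →
      ∑ (allFin m) (λ i → ∑ (allFin (suc n)) (λ j →
        (φ (inject₁ i) j - φ (Fin.suc i) j) * ((α (inject₁ i) - α (Fin.suc i)) * γ j)))
    + ∑ (allFin (suc m)) (λ i → ∑ (allFin n) (λ j →
        (φ i (inject₁ j) - φ i (Fin.suc j)) * (α i * (γ (inject₁ j) - γ (Fin.suc j)))))
    ≈ q * (α Fin.zero * γ Fin.zero - α (fromℕ m) * γ (fromℕ n))

  -- Transposing the grid exchanges the two sums, so facts about horizontal currents transfer to
  -- vertical ones.
  IsElectrical-flip : ∀ {m n} {φ : Fin (suc m) → Fin (suc n) → Carrier} → IsElectrical m n φ → IsElectrical n m (flip φ)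
  IsElectrical-flip {m} {n} {φ} electrical α γ = trans (+-comm _ _) (trans (+-cong
    (trans (∑-swap (allFin (suc n)) (allFin m) _) (∑-cong (allFin m) (λ i →
      ∑-cong (allFin (suc n)) (λ j → *-congˡ (*-comm _ _)))))
    (trans (∑-swap (allFin n) (allFin (suc m)) _) (∑-cong (allFin (suc m)) (λ i →
      ∑-cong (allFin n) (λ j → *-congˡ (*-comm _ _))))))
    (trans (electrical γ α) (*-congˡ (+-cong (*-comm _ _) (-‿cong (*-comm _ _))))))

  module _ {m n} {φ : Fin (suc (suc m)) → Fin (suc n) → Carrier} (electrical : IsElectrical (suc m) n φ) where

    current : Fin (suc m) → Fin (suc n) → Carrier
    current i j = φ (inject₁ i) j - φ (Fin.suc i) j

    -- At a minimum (i , j) of the current, test with (1ᵢ − 1ᵢ₊₁) ⊗ 1ⱼ: the discrete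
    -- Laplacian of the current is nonnegative, while its terms at a minimum are nonpositive.
    module Minimum {μ} (μ≤0 : μ ≤ 0#) (μ≤current : ∀ i j → μ ≤ current i j)
                   (i : Fin (suc m)) (j : Fin (suc n)) (minimum : current i j ≈ μ) where

      α : Fin (suc (suc m)) → Carrier
      α a = 𝟙 (a Fin.≟ inject₁ i) - 𝟙 (a Fin.≟ Fin.suc i)

      γ : Fin (suc n) → Carrier
      γ b = 𝟙 (b Fin.≟ j)

      Δα : Fin (suc m) → Carrier
      Δα k = α (inject₁ k) - α (Fin.suc k)

      Δγ : Fin n → Carrier
      Δγ b = γ (inject₁ b) - γ (Fin.suc b)

      0≤𝟙-0 : ∀ {P Q : Set} (P? : Dec P) (Q? : Dec Q) → ¬ Q → 0# ≤ 𝟙 P? - 𝟙 Q?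
      0≤𝟙-0 P? Q? ¬Q = ≤-respʳ-≈ (sym (trans (+-congˡ (trans (-‿cong (𝟙-no Q? ¬Q)) -0#≈0#)) (+-identityʳ _))) (0≤𝟙 P?)

      0-𝟙≤0 : ∀ {P Q : Set} (P? : Dec P) (Q? : Dec Q) → ¬ P → 𝟙 P? - 𝟙 Q? ≤ 0#
      0-𝟙≤0 P? Q? ¬P = ≤-by (𝟙 Q?) (0≤𝟙 Q?) (trans (sym (𝟙-no P? ¬P))
        (solve 2 (λ p q → p := p :- q :+ q) refl (𝟙 P?) (𝟙 Q?)))

      0≤α₀ : 0# ≤ α Fin.zero
      0≤α₀ = 0≤𝟙-0 (Fin.zero Fin.≟ inject₁ i) (Fin.zero Fin.≟ Fin.suc i) λ ()

      αₘ≤0 : α (fromℕ (suc m)) ≤ 0#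
      αₘ≤0 = 0-𝟙≤0 (fromℕ (suc m) Fin.≟ inject₁ i) (fromℕ (suc m) Fin.≟ Fin.suc i) Fin.fromℕ≢inject₁

      Δα≤0 : ∀ k → k ≢ i → Δα k ≤ 0#
      Δα≤0 k k≢i = ≤-respʳ-≈ (-‿inverseʳ 0#) (+-mono-≤
        (0-𝟙≤0 (inject₁ k Fin.≟ inject₁ i) (inject₁ k Fin.≟ Fin.suc i) (λ eq → k≢i (Fin.inject₁-injective eq)))
        (-‿anti-≤ (0≤𝟙-0 (Fin.suc k Fin.≟ inject₁ i) (Fin.suc k Fin.≟ Fin.suc i)
              (λ eq → k≢i (Fin.suc-injective eq)))))

      -- The weight `- Δα k` is 1 at the horizontal neighbours of `i` and 0 farther away; at `i` it
      -- is -2, but there the first factor vanishes.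
      excess : Fin (suc m) → Carrier
      excess k = (current k j - μ) * - Δα k

      0≤excess : ∀ k → 0# ≤ excess k
      0≤excess k = split (k Fin.≟ i)
        where
        split : Dec (k ≡ i) → 0# ≤ excess k
        split (yes ≡.refl) = ≤-reflexive (sym (trans (*-congʳ (trans (+-congʳ minimum) (-‿inverseʳ μ))) (zeroˡ _)))
        split (no  k≢i)    = *-nonNegative (x≤y⇒0≤y-x (μ≤current k j))
          (≤-respˡ-≈ -0#≈0# (-‿anti-≤ (Δα≤0 k k≢i)))

      vertical : Fin (suc (suc m)) → Fin n → Carrier
      vertical a b = φ a (inject₁ b) - φ a (Fin.suc b)

      horizontal-sum : ∑ (allFin (suc m)) (λ k → ∑ (allFin (suc n)) (λ b → current k b * (Δα k * γ b)))
                     ≈ μ * (α Fin.zero - α (fromℕ (suc m))) - ∑ (allFin (suc m)) excess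
      horizontal-sum = begin
        ∑ (allFin (suc m)) (λ k → ∑ (allFin (suc n)) (λ b → current k b * (Δα k * γ b)))
          ≈⟨ ∑-cong (allFin (suc m)) (λ k → trans (∑-cong (allFin (suc n)) (λ b →
               solve 3 (λ c a g → c :* (a :* g) := g :* (c :* a)) refl (current k b) (Δα k) (γ b)))
               (∑-allFin-δ j (λ b → current k b * Δα k))) ⟩
        ∑ (allFin (suc m)) (λ k → current k j * Δα k)
          ≈⟨ ∑-cong (allFin (suc m)) (λ k → solve 3
               (λ c u a → c :* a := u :* a :- (c :- u) :* (:- a)) refl (current k j) μ (Δα k)) ⟩
        ∑ (allFin (suc m)) (λ k → μ * Δα k - excess k)
          ≈⟨ ∑-- (allFin (suc m)) _ _ ⟩
        ∑ (allFin (suc m)) (λ k → μ * Δα k) - ∑ (allFin (suc m)) excess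
          ≈⟨ +-congʳ (trans (∑-*ˡ (allFin (suc m)) μ Δα) (*-congˡ (∑-allFin-telescope (suc m) α))) ⟩
        μ * (α Fin.zero - α (fromℕ (suc m))) - ∑ (allFin (suc m)) excess ∎

      -- Mixed differences commute: the vertical drops of `φ` in the two columns that bound arc `i`
      -- combine into vertical differences of the current.
      vertical-sum : ∑ (allFin (suc (suc m))) (λ a → ∑ (allFin n) (λ b → vertical a b * (α a * Δγ b)))
                   ≈ ∑ (allFin n) (λ b → (current i (inject₁ b) - current i (Fin.suc b)) * Δγ b)
      vertical-sum = begin
        ∑ (allFin (suc (suc m))) (λ a → ∑ (allFin n) (λ b → vertical a b * (α a * Δγ b)))
          ≈⟨ ∑-cong (allFin (suc (suc m))) (λ a → trans (∑-cong (allFin n) (λ b →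
               solve 3 (λ v a g → v :* (a :* g) := a :* (v :* g)) refl (vertical a b) (α a) (Δγ b)))
               (trans (∑-*ˡ (allFin n) (α a) _) (solve 3 (λ x y t → (x :- y) :* t :=
                     x :* t :- y :* t) refl _ _ _))) ⟩
        ∑ (allFin (suc (suc m))) (λ a → 𝟙 (a Fin.≟ inject₁ i) * T a - 𝟙 (a Fin.≟ Fin.suc i) * T a)
          ≈⟨ ∑-- (allFin (suc (suc m))) _ _ ⟩
        ∑ (allFin (suc (suc m))) (λ a → 𝟙 (a Fin.≟ inject₁ i) * T a)
          - ∑ (allFin (suc (suc m))) (λ a → 𝟙 (a Fin.≟ Fin.suc i) * T a)
          ≈⟨ +-cong (∑-allFin-δ (inject₁ i) T) (-‿cong (∑-allFin-δ (Fin.suc i) T)) ⟩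
        T (inject₁ i) - T (Fin.suc i)
          ≈⟨ ∑-- (allFin n) _ _ ⟨
        ∑ (allFin n) (λ b → vertical (inject₁ i) b * Δγ b - vertical (Fin.suc i) b * Δγ b)
          ≈⟨ ∑-cong (allFin n) (λ b → solve 5 (λ p p′ r r′ g →
               (p :- p′) :* g :- (r :- r′) :* g := (p :- r :- (p′ :- r′)) :* g) refl
               (φ (inject₁ i) (inject₁ b)) (φ (inject₁ i) (Fin.suc b))
               (φ (Fin.suc i) (inject₁ b)) (φ (Fin.suc i) (Fin.suc b)) (Δγ b)) ⟩
        ∑ (allFin n) (λ b → (current i (inject₁ b) - current i (Fin.suc b)) * Δγ b) ∎
        where
        T : Fin (suc (suc m)) → Carrier
        T a = ∑ (allFin n) (λ b → vertical a b * Δγ b)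

      z*[1-0]≤0 : ∀ {z} → z ≤ 0# → z * (1# - 0#) ≤ 0#
      z*[1-0]≤0 {z} = ≤-respˡ-≈ (sym (trans (*-congˡ (trans (+-congˡ -0#≈0#) (+-identityʳ 1#))) (*-identityʳ z)))

      z*[0-1]≤0 : ∀ {z} → 0# ≤ z → z * (0# - 1#) ≤ 0#
      z*[0-1]≤0 {z} 0≤z = ≤-by z 0≤z (sym (begin
        z * (0# - 1#) + z       ≈⟨ +-cong (*-congˡ (+-identityˡ _)) (sym (*-identityʳ z)) ⟩
        z * - 1# + z * 1#       ≈⟨ distribˡ z _ _ ⟨
        z * (- 1# + 1#)         ≈⟨ trans (*-congˡ (-‿inverseˡ 1#)) (zeroʳ z) ⟩
        0#                      ∎))

      0≤current- : ∀ b → 0# ≤ current i b - current i j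
      0≤current- b = x≤y⇒0≤y-x (≤-respˡ-≈ (sym minimum) (μ≤current i b))

      -- Only the arcs at height `j` contribute, and each compares the minimal current with a
      -- vertical neighbour.
      vertical-term≤0 : ∀ b → (current i (inject₁ b) - current i (Fin.suc b)) * Δγ b ≤ 0#
      vertical-term≤0 b with inject₁ b Fin.≟ j | Fin.suc b Fin.≟ j
      ... | yes ≡.refl | yes eq     = ⊥-elim (inject₁≢suc b (≡.sym eq))
      ... | yes ≡.refl | no  _      = z*[1-0]≤0 (≤-by _ (0≤current- (Fin.suc b))
        (solve 2 (λ c d → con (+ 0) := (c :- d) :+ (d :- c)) refl _ _))
      ... | no  _      | yes ≡.refl = z*[0-1]≤0 (0≤current- (inject₁ b))
      ... | no  _      | no  _      = ≤-reflexive (trans (*-congˡ (-‿inverseʳ 0#)) (zeroʳ _))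

      source-sink : 0# ≤ q * (α Fin.zero * γ Fin.zero - α (fromℕ (suc m)) * γ (fromℕ n))
      source-sink = *-nonNegative 0≤q (≤-respʳ-≈
        (solve 4 (λ a g a′ g′ → a :* g :+ (con (+ 0) :- a′) :* g′ := a :* g :- a′ :* g′) refl _ _ _ _)
        (+-nonNegative (*-nonNegative 0≤α₀ (0≤𝟙 (Fin.zero Fin.≟ j)))
                       (*-nonNegative (x≤y⇒0≤y-x αₘ≤0) (0≤𝟙 (fromℕ n Fin.≟ j)))))

      excess-bound : ∑ (allFin (suc m)) excess ≤ μ * (α Fin.zero - α (fromℕ (suc m)))
      excess-bound = ≤-by _ (+-nonNegative source-sink (x≤y⇒0≤y-x (≤-respʳ-≈ (∑-zero (allFin n))
          (∑-mono (allFin n) vertical-term≤0)))) (begin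
        B                       ≈⟨ solve 3 (λ b e v → b := e :+ (b :- e :+ v :+ (con (+ 0) :- v))) refl B E V ⟩
        E + (B - E + V + (0# - V)) ≈⟨ +-congˡ (+-congʳ (trans (sym (+-cong horizontal-sum vertical-sum)) (electrical α γ))) ⟩
        E + (q * (α Fin.zero * γ Fin.zero - α (fromℕ (suc m)) * γ (fromℕ n)) + (0# - V)) ∎)
        where
        B = μ * (α Fin.zero - α (fromℕ (suc m)))
        E = ∑ (allFin (suc m)) excess
        V = ∑ (allFin n) (λ b → (current i (inject₁ b) - current i (Fin.suc b)) * Δγ b)

      μ*α₀≥0 : 0# ≤ μ * (α Fin.zero - α (fromℕ (suc m)))
      μ*α₀≥0 = ≤-trans (∑-nonNegative (allFin (suc m)) 0≤excess) excess-bound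

      excess≈0 : ∀ k → excess k ≈ 0#
      excess≈0 k = ∑≈0⇒≈0 0≤excess (≤-trans excess-bound (≤-by ((0# - μ) * (α Fin.zero - α (fromℕ (suc m))))
        (*-nonNegative (x≤y⇒0≤y-x μ≤0) (≤-respʳ-≈
          (solve 2 (λ a b → a :+ (con (+ 0) :- b) := a :- b) refl _ _)
          (+-nonNegative 0≤α₀ (x≤y⇒0≤y-x αₘ≤0))))
        (solve 2 (λ u a → con (+ 0) := u :* a :+ (con (+ 0) :- u) :* a) refl μ _))) (∈-allFin k)

    -- A minimum in position i + 1 spreads to position i, where the weight is 1 and `excess` is
    -- zero. In position 0, `α Fin.zero` is 1, and 0 ≤ μ(1 - αₘ) ≤ μ contradicts μ < 0.
    no-negative-minimum : ∀ {μ} → μ < 0# → (∀ i j → μ ≤ current i j) → ∀ i j → ¬ current i j ≈ μ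
    no-negative-minimum {μ} (μ≤0 , μ≉0) μ≤current i j = <-weakInduction
      (λ i → ¬ current i j ≈ μ) first step i
      where
      first : ¬ current Fin.zero j ≈ μ
      first minimum = <⇒≱ (μ≤0 , μ≉0) (≤-trans μ*α₀≥0 (≤-by ((0# - μ) * (0# - α (fromℕ (suc m))))
        (*-nonNegative (x≤y⇒0≤y-x μ≤0) (x≤y⇒0≤y-x αₘ≤0)) (begin
          μ                                     ≈⟨ *-identityʳ μ ⟨
          μ * 1#                                ≈⟨ solve 3 (λ u o a → u :* o :=
                u :* (o :- con (+ 0) :- a) :+ (con (+ 0) :- u) :* (con (+ 0) :- a)) refl μ 1# (α (fromℕ (suc m))) ⟩
          μ * (1# - 0# - α (fromℕ (suc m))) + (0# - μ) * (0# - α (fromℕ (suc m))) ∎)))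
        where open Minimum μ≤0 μ≤current Fin.zero j minimum

      step : ∀ i → ¬ current (inject₁ i) j ≈ μ → ¬ current (Fin.suc i) j ≈ μ
      step i ¬minimum minimum = ¬minimum (begin
        current (inject₁ i) j                 ≈⟨ solve 2 (λ c u → c := c :- u :+ u) refl _ μ ⟩
        current (inject₁ i) j - μ + μ         ≈⟨ +-congʳ (begin
          current (inject₁ i) j - μ             ≈⟨ *-identityʳ _ ⟨
          (current (inject₁ i) j - μ) * 1#      ≈⟨ *-congˡ (solve 1 (λ o → o :=
                :- (con (+ 0) :- con (+ 0) :- (o :- con (+ 0)))) refl 1#) ⟩
          (current (inject₁ i) j - μ) * - (0# - 0# - (1# - 0#))
            ≈⟨ *-congˡ (-‿cong (+-cong
                 (+-cong (𝟙-no (inject₁ (inject₁ i) Fin.≟ Fin.suc (inject₁ i)) (inject₁≢suc (inject₁ i)))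
                         (-‿cong (𝟙-no (inject₁ (inject₁ i) Fin.≟ Fin.suc (Fin.suc i)) inject₁²≢suc²)))
                 (-‿cong (+-cong (𝟙-yes (Fin.suc (inject₁ i) Fin.≟ Fin.suc (inject₁ i)) ≡.refl)
                         (-‿cong (𝟙-no (Fin.suc (inject₁ i) Fin.≟ Fin.suc (Fin.suc i))
                           (λ eq → inject₁≢suc i (Fin.suc-injective eq)))))))) ⟨
          excess (inject₁ i)                    ≈⟨ excess≈0 (inject₁ i) ⟩
          0#                                    ∎) ⟩
        0# + μ                                ≈⟨ +-identityˡ μ ⟩
        μ                                     ∎)
        where
        open Minimum μ≤0 μ≤current (Fin.suc i) j minimum
        inject₁²≢suc² : inject₁ (inject₁ i) ≢ Fin.suc (Fin.suc i)
        inject₁²≢suc² eq = ℕ.m≢1+m+n (toℕ i) (≡.trans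
          (≡.sym (≡.trans (Fin.toℕ-inject₁ (inject₁ i)) (Fin.toℕ-inject₁ i)))
          (≡.trans (≡.cong toℕ eq) (≡.cong suc (≡.sym (ℕ.+-comm (toℕ i) 1)))))

    0≤current : ∀ i j → 0# ≤ current i j
    0≤current i j = ≤-trans 0≤least (least≤ i j)
      where
      cells : List (Fin (suc m) × Fin (suc n))
      cells = cartesianProduct (allFin (suc m)) (allFin (suc n))

      least : Fin (suc m) × Fin (suc n)
      least = argmin (uncurry current) (i , j) cells

      least≤ : ∀ i′ j′ → uncurry current least ≤ current i′ j′
      least≤ i′ j′ = All.lookup (f[argmin]≤f[xs] {f = uncurry current} (i , j) cells)
        (∈-cartesianProduct⁺ (∈-allFin i′) (∈-allFin j′))

      0≤least : 0# ≤ uncurry current least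
      0≤least = ≮⇒≥ (λ least<0 → no-negative-minimum least<0 least≤ (proj₁ least) (proj₂ least) refl)

  antitone : ∀ {n} (F : Fin (suc n) → Carrier) → (∀ i → 0# ≤ F (inject₁ i) - F (Fin.suc i)) →
             ∀ {i j} → i Fin.≤ j → F j ≤ F i
  antitone F decreasing {i} = <-weakInduction-startingFrom (λ j → F j ≤ F i) ≤-refl
    (λ j Fj≤Fi → ≤-trans (≤-by _ (decreasing j)
      (solve 2 (λ a b → a := b :+ (a :- b)) refl (F (inject₁ j)) (F (Fin.suc j)))) Fj≤Fi)

-- Number of grid steps left to the sink.

gridLevel : ∀ {m n} → GridVertex m n → ℕ
gridLevel {m} {n} (i , j) = (m ℕ.∸ toℕ i) ℕ.+ (n ℕ.∸ toℕ j)

∸-inject₁ : ∀ {m} (i : Fin m) → m ℕ.∸ toℕ (inject₁ i) ≡ suc (m ℕ.∸ toℕ (Fin.suc i))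
∸-inject₁ {m} i rewrite Fin.toℕ-inject₁ i = ℕ.+-∸-assoc 1 (Fin.toℕ<n i)

gridLevel-src : ∀ {m n} (e : GridArc m n) → gridLevel (gridSrc e) ≡ suc (gridLevel (gridTgt e))
gridLevel-src {m} {n} (inj₁ (i , j)) rewrite ∸-inject₁ i = ≡.refl
gridLevel-src {m} {n} (inj₂ (i , j)) rewrite ∸-inject₁ j = ℕ.+-suc (m ℕ.∸ toℕ i) _

gridLevel-zero : ∀ {m n} (v : GridVertex m n) → gridLevel v ≡ 0 → v ≡ (fromℕ m , fromℕ n)
gridLevel-zero {m} {n} (i , j) eq = ≡.cong₂ _,_
  (last i (ℕ.m+n≡0⇒m≡0 (m ℕ.∸ toℕ i) eq)) (last j (ℕ.m+n≡0⇒n≡0 (m ℕ.∸ toℕ i) eq))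
  where
  last : ∀ {k} (i : Fin (suc k)) → k ℕ.∸ toℕ i ≡ 0 → i ≡ fromℕ k
  last {k} i k∸i≡0 = Fin.toℕ-injective (≡.trans
    (ℕ.≤-antisym (ℕ.≤-pred (Fin.toℕ<n i)) (ℕ.m∸n≡0⇒m≤n k∸i≡0)) (≡.sym (Fin.toℕ-fromℕ k)))

-- The value at the sink is arbitrary.
gridExit : ∀ {m n} → GridVertex (suc m) n → GridArc (suc m) n
gridExit (i , j) with view i | view j
... | ‵inject₁ i′ | _           = inj₁ (i′ , j)
... | ‵fromℕ      | ‵inject₁ j′ = inj₂ (i , j′)
... | ‵fromℕ      | ‵fromℕ      = inj₁ (Fin.zero , j)

gridSrc-exit : ∀ {m n k} (v : GridVertex (suc m) n) → gridLevel v ≡ suc k → gridSrc (gridExit v) ≡ v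
gridSrc-exit {m} {n} (i , j) eq with view i | view j
... | ‵inject₁ i′ | _           = ≡.refl
... | ‵fromℕ      | ‵inject₁ j′ = ≡.refl
... | ‵fromℕ      | ‵fromℕ
  rewrite Fin.toℕ-fromℕ m | Fin.toℕ-fromℕ n | ℕ.n∸n≡0 m | ℕ.n∸n≡0 n with () ← eq

-- Coordinate test potentials on the grid.

module GridPotentials (ℝ : CompleteOrderedField) (m n : ℕ) where

  open OrderedField ℝ
  open Sums ℝ
  open Potentials ℝ (grid m n) public
  open import Relation.Binary.Reasoning.Setoid setoid

  ∑→ : (Fin m → Fin (suc n) → Carrier) → Carrier
  ∑→ X = ∑ (allFin m) (λ i → ∑ (allFin (suc n)) (X i))

  ∑↑ : (Fin (suc m) → Fin n → Carrier) → Carrier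
  ∑↑ Y = ∑ (allFin (suc m)) (λ i → ∑ (allFin n) (Y i))

  ∑-gridArcs : ∀ F → ∑ (gridArcs m n) F ≈ ∑→ (λ i j → F (inj₁ (i , j))) + ∑↑ (λ i j → F (inj₂ (i , j)))
  ∑-gridArcs F = trans
    (∑-++ (map inj₁ (cartesianProduct (allFin m) (allFin (suc n)))) _ F)
    (+-cong
      (trans (∑-map inj₁ (cartesianProduct (allFin m) (allFin (suc n))) F)
             (∑-cartesianProduct (allFin m) (allFin (suc n)) (F ∘ inj₁)))
      (trans (∑-map inj₂ (cartesianProduct (allFin (suc m)) (allFin n)) F)
             (∑-cartesianProduct (allFin (suc m)) (allFin n) (F ∘ inj₂))))

  ∑→-cong : ∀ {X Y} → (∀ i j → X i j ≈ Y i j) → ∑→ X ≈ ∑→ Y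
  ∑→-cong X≈Y = ∑-cong (allFin m) (λ i → ∑-cong (allFin (suc n)) (X≈Y i))

  ∑↑-cong : ∀ {X Y} → (∀ i j → X i j ≈ Y i j) → ∑↑ X ≈ ∑↑ Y
  ∑↑-cong X≈Y = ∑-cong (allFin (suc m)) (λ i → ∑-cong (allFin n) (X≈Y i))

  ∑→-zero : ∑→ (λ _ _ → 0#) ≈ 0#
  ∑→-zero = trans (∑-cong (allFin m) (λ _ → ∑-zero (allFin (suc n)))) (∑-zero (allFin m))

  ∑↑-zero : ∑↑ (λ _ _ → 0#) ≈ 0#
  ∑↑-zero = trans (∑-cong (allFin (suc m)) (λ _ → ∑-zero (allFin n))) (∑-zero (allFin (suc m)))

  -- Negated because `drop` subtracts the target's value: the drops are 1 on horizontal, on vertical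
  -- and on all arcs, so pairing with them sums a flow over those arcs.
  -column -row -level : GridVertex m n → Carrier
  -column (i , j) = - nat (toℕ i)
  -row    (i , j) = - nat (toℕ j)
  -level  v       = -column v + -row v

  drop-toℕ : ∀ {k} (i : Fin k) → - nat (toℕ (inject₁ i)) - - nat (toℕ (Fin.suc i)) ≈ 1#
  drop-toℕ i rewrite Fin.toℕ-inject₁ i = solve 2 (λ a o → :- a :- :- (o :+ a) := o) refl (nat (toℕ i)) 1#

  drop-level : ∀ e → drop -level e ≈ 1#
  drop-level (inj₁ (i , j)) = trans
    (solve 3 (λ a b c → a :+ c :- (b :+ c) := a :- b) refl _ _ _) (drop-toℕ i)
  drop-level (inj₂ (i , j)) = trans
    (solve 3 (λ a b c → c :+ a :- (c :+ b) := a :- b) refl _ _ _) (drop-toℕ j)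

  ⟪,drop-column⟫ : ∀ X → ⟪ X , drop -column ⟫ ≈ ∑→ (λ i j → X (inj₁ (i , j)))
  ⟪,drop-column⟫ X = trans (∑-gridArcs _) (trans (+-cong
    (∑→-cong (λ i j → trans (*-congˡ (drop-toℕ i)) (*-identityʳ _)))
    (trans (∑↑-cong (λ i j → trans (*-congˡ (-‿inverseʳ _)) (zeroʳ _))) ∑↑-zero)) (+-identityʳ _))

  ⟪,drop-row⟫ : ∀ X → ⟪ X , drop -row ⟫ ≈ ∑↑ (λ i j → X (inj₂ (i , j)))
  ⟪,drop-row⟫ X = trans (∑-gridArcs _) (trans (+-cong
    (trans (∑→-cong (λ i j → trans (*-congˡ (-‿inverseʳ _)) (zeroʳ _))) ∑→-zero)
    (∑↑-cong (λ i j → trans (*-congˡ (drop-toℕ j)) (*-identityʳ _)))) (+-identityˡ _))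

  ⟪,drop-level⟫ : ∀ X → ⟪ X , drop -level ⟫ ≈ ∑ (gridArcs m n) X
  ⟪,drop-level⟫ X = ∑-cong (gridArcs m n) (λ e → trans (*-congˡ (drop-level e)) (*-identityʳ (X e)))

  gridPotential : ∀ X → ∃ λ φ → ∀ θ → ⟪ drop φ , drop θ ⟫ ≈ ⟪ X , drop θ ⟫
  gridPotential = ∃-potential
    (Unique.cartesianProduct⁺ (Unique.allFin⁺ (suc m)) (Unique.allFin⁺ (suc n)))
    (λ (i , j) → ∈-cartesianProduct⁺ (∈-allFin i) (∈-allFin j))

  ∑-affine : ∀ a b X Y → ∑ (gridArcs m n) (λ e → X e * (a * Y e + b)) ≈ a * ⟪ X , Y ⟫ + b * ∑ (gridArcs m n) X
  ∑-affine a b X Y = trans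
    (∑-cong (gridArcs m n) (λ e → solve 4 (λ a b x y → x :* (a :* y :+ b) :=
          a :* (x :* y) :+ b :* x) refl a b (X e) (Y e)))
    (trans (∑-+ (gridArcs m n) _ _) (+-cong (∑-*ˡ (gridArcs m n) a _) (∑-*ˡ (gridArcs m n) b X)))

  2⟪⟫≤ : ∀ X Y → ⟪ X , Y ⟫ + ⟪ X , Y ⟫ ≤ ⟪ X , X ⟫ + ⟪ Y , Y ⟫
  2⟪⟫≤ X Y = ≤-respˡ-≈ (∑-+ (gridArcs m n) _ _) (≤-respʳ-≈ (∑-+ (gridArcs m n) _ _)
    (∑-mono (gridArcs m n) (λ e → ≤-by _ (0≤x² (X e - Y e))
      (solve 2 (λ x y → x :* x :+ y :* y := x :* y :+ x :* y :+ (x :- y) :* (x :- y)) refl (X e) (Y e)))))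

-- Energy and column drops of the electrical flow.

module ElectricalFlow (ℝ : CompleteOrderedField) (m n : ℕ) where

  open OrderedField ℝ
  open Sums ℝ
  open GridPotentials ℝ (suc m) (suc n)
  open Network (grid (suc m) (suc n)) using (s; t)
  open import Relation.Binary.Reasoning.Setoid setoid

  module Potential
    {q} (0≤q : 0# ≤ q) (φ : GridVertex (suc m) (suc n) → Carrier)
    (div : ∀ θ → ⟪ drop φ , drop θ ⟫ ≈ q * (θ s - θ t)) where

    open Monotonicity ℝ 0≤q

    electrical : IsElectrical (suc m) (suc n) (λ i j → φ (i , j))
    electrical α γ = trans (sym (trans (∑-gridArcs _) (+-cong
      (∑→-cong (λ i j → *-congˡ (solve 3 (λ a b g → a :* g :- b :* g := (a :- b) :* g) refl _ _ _)))
      (∑↑-cong (λ i j → *-congˡ (solve 3 (λ a g g′ → a :* g :- a :* g′ := a :* (g :- g′)) refl _ _ _))))))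
      (div (λ (i , j) → α i * γ j))

    0≤drop : ∀ e → 0# ≤ drop φ e
    0≤drop (inj₁ (i , j)) = 0≤current {φ = λ i j → φ (i , j)} electrical i j
    0≤drop (inj₂ (i , j)) = 0≤current {φ = λ j i → φ (i , j)}
      (IsElectrical-flip {φ = λ i j → φ (i , j)} electrical) j i

    antitone-column : ∀ {i i′} j → i Fin.≤ i′ → φ (i′ , j) ≤ φ (i , j)
    antitone-column j = antitone (λ i → φ (i , j)) (λ i → 0≤drop (inj₁ (i , j)))

    antitone-row : ∀ i {j j′} → j Fin.≤ j′ → φ (i , j′) ≤ φ (i , j)
    antitone-row i = antitone (λ j → φ (i , j)) (λ j → 0≤drop (inj₂ (i , j)))

    nat-toℕ-fromℕ : ∀ k → - 0# - - nat (toℕ (fromℕ k)) ≈ nat k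
    nat-toℕ-fromℕ k rewrite Fin.toℕ-fromℕ k = solve 1 (λ x → :- con (+ 0) :- :- x := x) refl (nat k)

    horizontal-total : ∑→ (λ i j → drop φ (inj₁ (i , j))) ≈ q * nat (suc m)
    horizontal-total = trans (sym (⟪,drop-column⟫ (drop φ))) (trans (div -column) (*-congˡ (nat-toℕ-fromℕ (suc m))))

    vertical-total : ∑↑ (λ i j → drop φ (inj₂ (i , j))) ≈ q * nat (suc n)
    vertical-total = trans (sym (⟪,drop-row⟫ (drop φ))) (trans (div -row) (*-congˡ (nat-toℕ-fromℕ (suc n))))

    total-drop : ∑ (gridArcs (suc m) (suc n)) (drop φ) ≈ q * (nat (suc m) + nat (suc n))
    total-drop = trans (∑-gridArcs (drop φ)) (trans (+-cong horizontal-total vertical-total) (sym (distribˡ q _ _)))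

    energy : Carrier
    energy = ⟪ drop φ , drop φ ⟫

    -- Cauchy–Schwarz over the horizontal arcs.
    energy-bound : q * q * nat (suc m) ≤ nat (suc (suc n)) * energy
    energy-bound = ≤-trans
      (*-cancelˡ-≤ (0<nat (suc n)) (≤-by D (∑-nonNegative (allFin (suc m)) (λ i →
        ∑-nonNegative (allFin (suc (suc n))) (λ j → 0≤x² _))) (begin
          N * (N * H→)
            ≈⟨ solve 4 (λ N H q M → N :* (N :* H) :=
                  N :* (q :* q :* M) :+ (N :* N :* H :- N :* q :* (q :* M) :- N :* q :* (q :* M) :+ M :* (N :* (q :* q)))) refl N H→ q (nat (suc m)) ⟩
          N * (q * q * nat (suc m)) + (N * N * H→ - N * q * (q * nat (suc m))
                - N * q * (q * nat (suc m)) + nat (suc m) * (N * (q * q)))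
            ≈⟨ +-congˡ expand ⟨
          N * (q * q * nat (suc m)) + D ∎)))
      (*-monoˡ-≤ (0≤nat (suc (suc n))) (≤-by _ (∑-nonNegative (allFin (suc (suc m))) (λ i →
        ∑-nonNegative (allFin (suc n)) (λ j → 0≤x² (drop φ (inj₂ (i , j)))))) (∑-gridArcs _)))
      where
      N = nat (suc (suc n))
      h : Fin (suc m) → Fin (suc (suc n)) → Carrier
      h i j = drop φ (inj₁ (i , j))
      H→ = ∑→ (λ i j → h i j * h i j)
      -- The variance of the horizontal flow with denominators cleared: each cut between adjacent
      -- columns has `N` arcs, with mean flow q/N.
      D = ∑→ (λ i j → (N * h i j - q) * (N * h i j - q))
      expand : D ≈ N * N * H→ - N * q * (q * nat (suc m)) - N * q * (q * nat (suc m))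
            + nat (suc m) * (N * (q * q))
      expand = trans (∑→-cong (λ i j → solve 3 (λ N h q → (N :* h :- q) :* (N :* h :- q)
                 := N :* N :* (h :* h) :- N :* q :* h :- N :* q :* h :+ q :* q) refl N (h i j) q))
        (trans (∑→-+ _ _) (+-cong (trans (∑→-- _ _) (+-cong (trans (∑→-- _ _) (+-cong (∑→-*ˡ (N * N) _)
          (-‿cong Nqh))) (-‿cong Nqh))) constant))
        where
        ∑→-+ : ∀ X Y → ∑→ (λ i j → X i j + Y i j) ≈ ∑→ X + ∑→ Y
        ∑→-+ X Y = trans (∑-cong (allFin (suc m))
              (λ i → ∑-+ (allFin (suc (suc n))) (X i) (Y i))) (∑-+ (allFin (suc m)) _ _)
        ∑→-- : ∀ X Y → ∑→ (λ i j → X i j - Y i j) ≈ ∑→ X - ∑→ Y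
        ∑→-- X Y = trans (∑-cong (allFin (suc m))
              (λ i → ∑-- (allFin (suc (suc n))) (X i) (Y i))) (∑-- (allFin (suc m)) _ _)
        ∑→-*ˡ : ∀ c X → ∑→ (λ i j → c * X i j) ≈ c * ∑→ X
        ∑→-*ˡ c X = trans (∑-cong (allFin (suc m))
              (λ i → ∑-*ˡ (allFin (suc (suc n))) c (X i))) (∑-*ˡ (allFin (suc m)) c _)
        Nqh : ∑→ (λ i j → N * q * h i j) ≈ N * q * (q * nat (suc m))
        Nqh = trans (∑→-*ˡ (N * q) h) (*-congˡ horizontal-total)
        constant : ∑→ (λ _ _ → q * q) ≈ nat (suc m) * (N * (q * q))
        constant = trans (∑-cong (allFin (suc m))
              (λ _ → ∑-allFin-const (suc (suc n)) (q * q))) (∑-allFin-const (suc m) _)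

    columnDrop : Fin (suc (suc m)) → Carrier
    columnDrop i = φ (i , Fin.zero) - φ (i , fromℕ (suc n))

    columnDrop-total : ∑ (allFin (suc (suc m))) columnDrop ≈ q * nat (suc n)
    columnDrop-total = trans (∑-cong (allFin (suc (suc m))) (λ i → sym (∑-allFin-telescope (suc n)
          (λ j → φ (i , j))))) vertical-total

    0≤columnDrop : ∀ i → 0# ≤ columnDrop i
    0≤columnDrop i = x≤y⇒0≤y-x (antitone-row i ℕ.z≤n)

    -- Every column between u and v drops by at least φ v − φ u.
    rise-bound : ∀ (u v : GridVertex (suc m) (suc n)) → 0# ≤ φ v - φ u →
                 (nat (toℕ (proj₁ v)) - nat (toℕ (proj₁ u))) * (φ v - φ u) ≤ q * nat (suc n)
    rise-bound u@(u₁ , u₂) v@(v₁ , v₂) 0≤rise = ≤-respˡ-≈ count (≤-respʳ-≈ columnDrop-total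
      (∑-mono (allFin (suc (suc m))) (λ i → column i (toℕ i ℕ.<? toℕ v₁) (toℕ i ℕ.<? toℕ u₁))))
      where
      rise = φ v - φ u
      count : ∑ (allFin (suc (suc m))) (λ i → (𝟙 (toℕ i ℕ.<? toℕ v₁) - 𝟙 (toℕ i ℕ.<? toℕ u₁)) * rise)
            ≈ (nat (toℕ v₁) - nat (toℕ u₁)) * rise
      count = trans (∑-*ʳ (allFin (suc (suc m))) _ rise) (*-congʳ (trans (∑-- (allFin (suc (suc m))) _ _)
        (+-cong (∑-allFin-< (ℕ.<⇒≤ (Fin.toℕ<n v₁))) (-‿cong (∑-allFin-< (ℕ.<⇒≤ (Fin.toℕ<n u₁)))))))
      column : ∀ i (i<v? : Dec (toℕ i ℕ.< toℕ v₁)) (i<u? : Dec (toℕ i ℕ.< toℕ u₁)) →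
               (𝟙 i<v? - 𝟙 i<u?) * rise ≤ columnDrop i
      column i (yes _)   (yes _)   = ≤-respˡ-≈ (sym (trans (*-congʳ (-‿inverseʳ 1#)) (zeroˡ rise))) (0≤columnDrop i)
      column i (no _)    (no _)    = ≤-respˡ-≈ (sym (trans (*-congʳ (-‿inverseʳ 0#)) (zeroˡ rise))) (0≤columnDrop i)
      -- The chord points left across this column: the count is -1 and the left side is nonpositive.
      column i (no _)    (yes _)   = ≤-trans (≤-by (1# * rise) (*-nonNegative 0≤1 0≤rise)
        (solve 2 (λ o r → con (+ 0) := (con (+ 0) :- o) :* r :+ o :* r) refl 1# rise)) (0≤columnDrop i)
      -- With u₁ ≤ i < v₁, monotonicity gives φ v ≤ φ(v₁, 0) ≤ φ(i, 0) and φ(i, n + 1) ≤ φ(i, u₂) ≤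
      -- φ u.
      column i (yes i<v) (no i≮u)  = ≤-respˡ-≈
        (sym (trans (*-congʳ (trans (+-congˡ -0#≈0#) (+-identityʳ 1#))) (*-identityˡ rise)))
        (+-mono-≤ (≤-trans (antitone-row v₁ {Fin.zero} ℕ.z≤n) (antitone-column Fin.zero (ℕ.<⇒≤ i<v)))
                  (-‿anti-≤ (≤-trans (antitone-row i (Fin.≤fromℕ u₂)) (antitone-column u₂ (ℕ.≮⇒≥ i≮u)))))

-- Old and new costs against the electrical flow.

module InstanceBound
  (ℝ : CompleteOrderedField) (m n : ℕ) (I : Braess.Instance ℝ (suc m) (suc n)) where

  open OrderedField ℝ
  open Sums ℝ
  open GridPotentials ℝ (suc m) (suc n)
  open Braess.Instance I
  open import Relation.Binary.Reasoning.Setoid setoid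

  N⁺ : Network
  N⁺ = gridWithChord (suc m) (suc n) chord

  s t u v : GridVertex (suc m) (suc n)
  s = Network.s N⁺
  t = Network.t N⁺
  u = Chord.from chord
  v = Chord.to chord

  ℓ⁺ : Network.Arc N⁺ → Carrier → Carrier
  ℓ⁺ = maybe′ (const (Braess.affine ℝ a b)) (Braess.affine ℝ c d)

  module OldEquilibrium = Equilibrium ℝ (grid (suc m) (suc n)) (const (Braess.affine ℝ a b)) (λ ()) fOldUE
  module NewEquilibrium = Equilibrium ℝ N⁺ ℓ⁺ (λ ()) fNewUE

  φ : GridVertex (suc m) (suc n) → Carrier
  φ = proj₁ (gridPotential fOld)

  0≤a : 0# ≤ a
  0≤a = proj₁ 0<a

  0≤q : 0# ≤ q
  0≤q = proj₁ 0<q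

  ⟪drop-φ,drop⟫ : ∀ θ → ⟪ drop φ , drop θ ⟫ ≈ q * (θ s - θ t)
  ⟪drop-φ,drop⟫ θ = trans (proj₂ (gridPotential fOld) θ) (OldEquilibrium.⟪flow,drop⟫ θ)

  module Electrical = ElectricalFlow.Potential ℝ m n 0≤q φ ⟪drop-φ,drop⟫
  open Electrical

  h g : GridArc (suc m) (suc n) → Carrier
  h = drop φ
  g e = fNew (just e)

  x S K rise cost₀ : Carrier
  x     = fNew nothing
  S     = nat (suc m) + nat (suc n)
  K     = -level u - -level v
  rise  = φ v - φ u
  cost₀ = a * energy + b * (q * S)

  0≤x : 0# ≤ x
  0≤x = Flows.Feasible.nonNegative (Flows.UserEquilibrium.feasible fNewUE) nothing

  x≤q : x ≤ q
  x≤q = NewEquilibrium.flow≤demand nothing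

  0≤energy : 0# ≤ energy
  0≤energy = ∑-nonNegative (gridArcs (suc m) (suc n)) (λ e → 0≤x² (h e))

  0≤S : 0# ≤ S
  0≤S = +-nonNegative (0≤nat (suc m)) (0≤nat (suc n))

  level-span : -level s - -level t ≈ S
  level-span rewrite Fin.toℕ-fromℕ m | Fin.toℕ-fromℕ n =
    solve 2 (λ x y → :- con (+ 0) :+ :- con (+ 0) :- (:- x :+ :- y) := x :+ y) refl (nat (suc m)) (nat (suc n))

  -- The projection property gives ⟨fOld, h⟩ = ⟨h, h⟩, so the difference of the two sides is the
  -- squared norm of fOld - h.
  energy≤fOld² : energy ≤ ⟪ fOld , fOld ⟫
  energy≤fOld² = ≤-by _ (x≤y⇒0≤y-x (2⟪⟫≤ fOld h)) (begin
    ⟪ fOld , fOld ⟫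
      ≈⟨ solve 2 (λ F H → F := H :+ (F :+ H :- (H :+ H))) refl _ energy ⟩
    energy + (⟪ fOld , fOld ⟫ + energy - (energy + energy))
      ≈⟨ +-congˡ (+-congˡ (-‿cong (+-cong h≈ h≈))) ⟩
    energy + (⟪ fOld , fOld ⟫ + energy - (⟪ fOld , h ⟫ + ⟪ fOld , h ⟫)) ∎)
    where
    h≈ = proj₂ (gridPotential fOld) φ

  cost₀≤old : cost₀ ≤ Old.cost fOld
  cost₀≤old = ≤-respʳ-≈ (sym (trans (∑-affine a b fOld fOld) (+-congˡ (*-congˡ (trans
    (sym (⟪,drop-level⟫ fOld)) (trans (OldEquilibrium.⟪flow,drop⟫ -level) (*-congˡ level-span)))))))
    (+-mono-≤ (*-monoˡ-≤ 0≤a energy≤fOld²) ≤-refl)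

  ∑-newArcs : ∀ F → ∑ (Network.arcs N⁺) F ≈ F nothing + ∑ (gridArcs (suc m) (suc n)) (F ∘ just)
  ∑-newArcs F = +-congˡ (∑-map just (gridArcs (suc m) (suc n)) F)

  ⟪g,drop⟫ : ∀ θ → x * (θ u - θ v) + ⟪ g , drop θ ⟫ ≈ q * (θ s - θ t)
  ⟪g,drop⟫ θ = trans (sym (∑-newArcs _)) (NewEquilibrium.⟪flow,drop⟫ θ)

  ⟪h,g⟫≈ : ⟪ h , g ⟫ ≈ energy + x * rise
  ⟪h,g⟫≈ = begin
    ⟪ h , g ⟫                               ≈⟨ ⟪⟫-comm h g ⟩
    ⟪ g , h ⟫                               ≈⟨ solve 4 (λ G x a b → G :=
          x :* (a :- b) :+ G :+ x :* (b :- a)) refl _ x (φ u) (φ v) ⟩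
    x * (φ u - φ v) + ⟪ g , h ⟫ + x * rise  ≈⟨ +-congʳ (trans (⟪g,drop⟫ φ) (sym (⟪drop-φ,drop⟫ φ))) ⟩
    energy + x * rise                       ∎

  -- The level potential measures total grid traffic; the chord carries `x` past `K` levels, with
  -- `K` negative if it points back.
  ∑g≈ : ∑ (gridArcs (suc m) (suc n)) g ≈ q * S - x * K
  ∑g≈ = begin
    ∑ (gridArcs (suc m) (suc n)) g       ≈⟨ ⟪,drop-level⟫ g ⟨
    ⟪ g , drop -level ⟫                  ≈⟨ solve 2 (λ G y → G := y :+ G :- y) refl _ (x * K) ⟩
    x * K + ⟪ g , drop -level ⟫ - x * K  ≈⟨ +-congʳ (trans (⟪g,drop⟫ -level) (*-congˡ level-span)) ⟩
    q * S - x * K                        ∎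

  new-lower : a * ⟪ g , g ⟫ + b * (q * S - x * K) ≤ New.cost fNew
  new-lower = ≤-by (x * (c * x + d))
    (*-nonNegative 0≤x (+-nonNegative (*-nonNegative 0≤c 0≤x) 0≤d))
    (trans (∑-newArcs _) (trans (+-congˡ (trans (∑-affine a b g g) (+-congˡ (*-congˡ ∑g≈)))) (+-comm _ _)))

  -- Taking `just` as the arc map measures distance along grid arcs only. This suffices because `h`
  -- lives on those arcs, and a grid path remains a competitor in the new network.
  open ShortestWalk ℝ N⁺ (λ e → ℓ⁺ e (fNew e)) (Network.complete (grid (suc m) (suc n))) just
    gridLevel gridLevel-src gridLevel-zero gridExit gridSrc-exit
    using (distance; distanceIn; shortestPath; shortest-length; distance-src)

  distance-t : distance t ≈ 0#
  distance-t rewrite Fin.toℕ-fromℕ m | Fin.toℕ-fromℕ n | ℕ.n∸n≡0 m | ℕ.n∸n≡0 n = refl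

  -- Variational inequality against h: the distance to t in the new latencies is a
  -- subsolution, and its drop from s to t is the latency of a path.
  new-upper : New.cost fNew ≤ a * ⟪ h , g ⟫ + b * (q * S)
  new-upper = ≤-trans (NewEquilibrium.cost≤demand*latency shortestPath)
    (≤-respˡ-≈ (begin
      ⟪ h , drop distance ⟫         ≈⟨ ⟪drop-φ,drop⟫ distance ⟩
      q * (distance s - distance t) ≈⟨ *-congˡ (trans (+-congˡ (trans (-‿cong distance-t) -0#≈0#)) (+-identityʳ _)) ⟩
      q * distance s                ≈⟨ *-congˡ (shortest-length (gridLevel s) s ≡.refl) ⟨
      q * New.latency fNew shortestPath ∎)
    (≤-respʳ-≈ (trans (∑-affine a b h g) (+-congˡ (*-congˡ total-drop)))
      (∑-mono (gridArcs (suc m) (suc n)) (λ e → *-monoˡ-≤ (0≤drop e) (x≤y+z⇒x-z≤y (distance-src e))))))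

  new≤cost₀+saving : New.cost fNew ≤ cost₀ + b * (x * K)
  new≤cost₀+saving = Estimates.cost-bound ℝ (q * S) (x * K) 0≤a new-lower new-upper (2⟪⟫≤ h g)

-- Bounds 2 and 5/4 on a single Braess ratio.

module RatioBound
  (ℝ : CompleteOrderedField) (m n : ℕ) (I : Braess.Instance ℝ (suc m) (suc n)) where

  open OrderedField ℝ
  open Estimates ℝ
  open GridPotentials ℝ (suc m) (suc n)
  open Braess.Instance I
  open InstanceBound ℝ m n I
  open Electrical using (energy; energy-bound)

  M N W : Carrier
  M = nat (suc m)
  N = nat (suc n)
  W = nat (toℕ (proj₁ v)) - nat (toℕ (proj₁ u))

  nat-toℕ≤ : ∀ {k} (i : Fin (suc k)) → 0# ≤ nat k - nat (toℕ i)
  nat-toℕ≤ i = x≤y⇒0≤y-x (nat-mono-≤ (ℕ.≤-pred (Fin.toℕ<n i)))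

  K≤W+N : K ≤ W + N
  K≤W+N = ≤-by _ (+-nonNegative (nat-toℕ≤ (proj₂ v)) (0≤nat (toℕ (proj₂ u))))
    (solve 5 (λ v₁ v₂ u₁ u₂ N →
      v₁ :- u₁ :+ N := (:- u₁ :+ :- u₂ :- (:- v₁ :+ :- v₂)) :+ (N :- v₂ :+ u₂)) refl
      (nat (toℕ (proj₁ v))) (nat (toℕ (proj₂ v))) (nat (toℕ (proj₁ u))) (nat (toℕ (proj₂ u))) N)

  K≤S : K ≤ S
  K≤S = ≤-trans K≤W+N (≤-by _ (+-nonNegative (nat-toℕ≤ (proj₁ v)) (0≤nat (toℕ (proj₁ u))))
    (solve 4 (λ M N v₁ u₁ → M :+ N := v₁ :- u₁ :+ N :+ (M :- v₁ :+ u₁)) refl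
      M N (nat (toℕ (proj₁ v))) (nat (toℕ (proj₁ u)))))

  bound-by-saving : ∀ r → nat r * K ≤ S → nat r * New.cost fNew ≤ nat (suc r) * cost₀
  bound-by-saving r = saving-bound r 0≤a 0≤b 0≤energy 0≤S 0≤x x≤q new≤cost₀+saving

  bound-by-rise : ∀ r → nat r * (x * rise) ≤ energy → nat r * New.cost fNew ≤ nat (suc r) * cost₀
  bound-by-rise r = Estimates.rise-bound ℝ r 0≤a 0≤b (*-nonNegative 0≤q 0≤S) new-upper ⟪h,g⟫≈

  -- A cut has n + 2 = N + 1 horizontal arcs; N + 1 ≤ 2N leaves a bound in `N` alone.
  energy-bound′ : q * q * M ≤ nat 2 * N * energy
  energy-bound′ = ≤-trans energy-bound (≤-by (nat n * energy) (*-nonNegative (0≤nat n) 0≤energy)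
    (solve 3 (λ o n H → con (+ 2) :* (o :+ n) :* H := (o :+ (o :+ n)) :* H :+ n :* H) refl 1# (nat n) energy))

  new≤2cost₀ : nat 1 * New.cost fNew ≤ nat 2 * cost₀
  new≤2cost₀ = bound-by-saving 1 (≤-respˡ-≈ (sym (trans (*-congʳ (+-identityʳ 1#)) (*-identityˡ K))) K≤S)

  4new≤5cost₀ : nat 8 * N ≤ M → nat 4 * New.cost fNew ≤ nat 5 * cost₀
  4new≤5cost₀ 8N≤M = short (total (nat 4 * K) S)
    where
    4*rise≤energy : S ≤ nat 4 * K → 0# ≤ rise ⊎ rise ≤ 0# → nat 4 * (x * rise) ≤ energy
    4*rise≤energy S≤4K (inj₁ 0≤rise) = energy-dominates (0<nat m) (0<nat n) 0≤q x≤q 0≤rise 8N≤M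
      (width-bound (0≤nat (suc n)) K≤W+N 8N≤M S≤4K) (Electrical.rise-bound u v 0≤rise) energy-bound′
    4*rise≤energy S≤4K (inj₂ rise≤0) = ≤-trans (≤-respʳ-≈ (trans (*-congˡ (zeroʳ x)) (zeroʳ (nat 4)))
      (*-monoˡ-≤ (0≤nat 4) (*-monoˡ-≤ 0≤x rise≤0))) 0≤energy

    short : nat 4 * K ≤ S ⊎ S ≤ nat 4 * K → nat 4 * New.cost fNew ≤ nat 5 * cost₀
    short (inj₁ 4K≤S) = bound-by-saving 4 4K≤S
    short (inj₂ S≤4K) = bound-by-rise 4 (4*rise≤energy S≤4K (total 0# rise))

  -- Zero energy would contradict the Cauchy-Schwarz bound, whose left side q²M is positive.
  0<energy : 0# < energy
  0<energy = 0≤energy , λ 0≈energy → <⇒≱ (*-positive (*-positive 0<q 0<q) (0<nat m))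
    (≤-trans energy-bound (≤-reflexive (trans (*-congˡ (sym 0≈energy)) (zeroʳ _))))

  0<old : 0# < Old.cost fOld
  0<old = <-≤-trans (<-≤-trans (*-positive 0<a 0<energy)
    (≤-by (b * (q * S)) (*-nonNegative 0≤b (*-nonNegative 0≤q 0≤S)) refl)) cost₀≤old

  braessRatio≤2 : braessRatio ≤ nat 2 / nat 1
  braessRatio≤2 = quotient-bound 0 0<old new≤2cost₀ cost₀≤old

  braessRatio≤5/4 : nat 8 * N ≤ M → braessRatio ≤ nat 5 / nat 4
  braessRatio≤5/4 8N≤M = quotient-bound 3 0<old (4new≤5cost₀ 8N≤M) cost₀≤old

-- Upper limit and comparison with the quadratic target.

module LimitBound (ℝ : CompleteOrderedField) where

  open Braess ℝ using (ℝ±; _≤±_; IsSupBraessRatio; Function; _⟨_⟩; IsO[r³]; ⟨0,1]; IsLimSupAlong; Instance)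
  open OrderedField ℝ
  open import Relation.Binary.Reasoning.Setoid setoid

  nat-cancel-≤ : ∀ {m n} → nat m ≤ nat n → m ℕ.≤ n
  nat-cancel-≤ {m} {n} m≤n with m ℕ.≤? n
  ... | yes p = p
  ... | no ¬p = ⊥-elim (<⇒≱ 0<1 (≤-by _ (x≤y⇒0≤y-x (≤-trans (nat-mono-≤ (ℕ.≰⇒> ¬p)) m≤n))
    (solve 2 (λ o n → con (+ 0) := o :+ (n :- (o :+ n))) refl 1# (nat n))))

  1≤n≤m : ∀ {r m n} → 0# < r → r ≤ 1# → 1 ℕ.≤ m → nat n ≈ r * nat m → 1 ℕ.≤ n × n ℕ.≤ m
  1≤n≤m {r} {suc m} {n} 0<r r≤1 _ n≈rm = 1≤n n n≈rm , nat-cancel-≤ (≤-respˡ-≈ (sym (trans n≈rm (*-comm r _)))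
    (≤-respʳ-≈ (*-identityʳ _) (*-monoˡ-≤ (0≤nat (suc m)) r≤1)))
    where
    1≤n : ∀ n → nat n ≈ r * nat (suc m) → 1 ℕ.≤ n
    1≤n zero    0≈rm = ⊥-elim (proj₂ (*-positive 0<r (0<nat m)) 0≈rm)
    1≤n (suc n) _    = ℕ.s≤s ℕ.z≤n

  -- A bound uniform in the size dominates each supremum, hence is an eventual bound already from m
  -- = 1.
  limSup≤ : ∀ {β r L U} → IsSupBraessRatio β → 0# < r → r ≤ 1# → IsLimSupAlong r β L →
            (∀ m n (I : Instance (suc m) (suc n)) → nat (suc n) ≈ r * nat (suc m) → Instance.braessRatio I ≤ U) →
            L ≤± [ U ]
  limSup≤ {β} {r} {L} {U} isSup 0<r r≤1 isLimSup ratio≤U = proj₁ isLimSup [ U ] (1 , eventually)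
    where
    eventually : ∀ m n → 1 ℕ.≤ m → nat n ≈ r * nat m → β m n ≤± [ U ]
    eventually m n 1≤m n≈rm with 1≤n≤m {n = n} 0<r r≤1 1≤m n≈rm
    eventually (suc m) (suc n) _ n≈rm | 1≤n , n≤m = proj₂ (isSup (suc m) (suc n) 1≤n n≤m) [ U ]
      λ { _ (I , ≡.refl) → AddExtrema.[ ratio≤U m n I n≈rm ] }

  small? : ∀ r → Dec (nat 8 * r ≤ nat 1)
  small? r = nat 8 * r ≤? nat 1

  correction : ∀ {P : Set} → Dec P → Carrier
  correction (yes _) = 0#
  correction (no _)  = 1#

  g : Function
  g = record
    { _⟨_⟩ = λ (r , _) → correction (small? r)
    ; cong = λ {(r , _)} {(r′ , _)} r≈r′ → agree r≈r′ (small? r) (small? r′)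
    }
    where
    agree : ∀ {r r′} → r ≈ r′ → (p : Dec (nat 8 * r ≤ nat 1)) (p′ : Dec (nat 8 * r′ ≤ nat 1)) →
            correction p ≈ correction p′
    agree r≈r′ (yes _) (yes _)  = refl
    agree r≈r′ (no _)  (no _)   = refl
    agree r≈r′ (yes p) (no ¬p′) = ⊥-elim (¬p′ (≤-respˡ-≈ (*-congˡ r≈r′) p))
    agree r≈r′ (no ¬p) (yes p′) = ⊥-elim (¬p (≤-respˡ-≈ (*-congˡ (sym r≈r′)) p′))

  ∣0∣≈0 : ∣ 0# ∣ ≈ 0#
  ∣0∣≈0 with IsDecTotalOrder.total isDecTotalOrder 0# 0#
  ... | inj₁ _ = refl
  ... | inj₂ _ = -0#≈0#

  nat≉0 : ∀ n → ¬ nat (suc n) ≈ 0#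
  nat≉0 n n≈0 = proj₂ (0<nat n) (sym n≈0)

  isO[r³] : IsO[r³] g
  -- Below 1/8 the error term vanishes, so the constant can be 0.
  isO[r³] = 0# , nat 8 ⁻¹ , 0<x⇒0<x⁻¹ (0<nat 7) , λ (r , _) r<δ → bound r (small? r) (proj₁ r<δ)
    where
    bound : ∀ r (p : Dec (nat 8 * r ≤ nat 1)) → r ≤ nat 8 ⁻¹ → ∣ correction p ∣ ≤ 0# * r ^ 3
    bound r (yes _) _   = ≤-reflexive (trans ∣0∣≈0 (sym (zeroˡ _)))
    bound r (no ¬p) r≤δ = ⊥-elim (¬p (≤-respʳ-≈
      (trans (*-inverseʳ (nat 8) (nat≉0 7)) (sym (+-identityʳ 1#))) (*-monoˡ-≤ (0≤nat 8) r≤δ)))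

  /-unique : ∀ {x y z} → ¬ z ≈ 0# → y * z ≈ x → x / z ≈ y
  /-unique {x} {y} {z} z≉0 yz≈x = begin
    x * z ⁻¹       ≈⟨ *-congʳ yz≈x ⟨
    y * z * z ⁻¹   ≈⟨ *-assoc y z _ ⟩
    y * (z * z ⁻¹) ≈⟨ *-congˡ (*-inverseʳ z z≉0) ⟩
    y * 1#         ≈⟨ *-identityʳ y ⟩
    y              ∎

  w : Carrier
  w = nat 108 ⁻¹

  0≤w : 0# ≤ w
  0≤w = proj₁ (0<x⇒0<x⁻¹ (0<nat 107))

  108w≈1 : nat 108 * w ≈ 1#
  108w≈1 = *-inverseʳ (nat 108) (nat≉0 107)

  -- Brings fractions to the common denominator 108, so that the solver meets a single inverse `w`.
  /≈*w : ∀ {k l} j → ¬ l ≈ 0# → j * l ≈ k * nat 108 → k / l ≈ j * w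
  /≈*w {k} {l} j l≉0 jl≈108k = /-unique l≉0 (begin
    j * w * l       ≈⟨ solve 3 (λ j w l → j :* w :* l := j :* l :* w) refl j w l ⟩
    j * l * w       ≈⟨ *-congʳ jl≈108k ⟩
    k * nat 108 * w ≈⟨ *-assoc k _ w ⟩
    k * (nat 108 * w) ≈⟨ trans (*-congˡ 108w≈1) (*-identityʳ k) ⟩
    k               ∎)

  target : Carrier → Carrier → Carrier
  target r z = nat 4 / nat 3 - (nat 2 / nat 9) * r + (nat 19 / nat 108) * r ^ 2 + z

  target≈ : ∀ r z → target r z ≈ nat 144 * w - nat 24 * w * r + nat 19 * w * (r * r) + z
  target≈ r z = +-congʳ (+-cong (+-cong
      (/≈*w (nat 144) (nat≉0 2)
        (solve 0 (con (+ 144) :* con (+ 3) := con (+ 4) :* con (+ 108)) refl))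
      (-‿cong (*-congʳ (/≈*w (nat 24) (nat≉0 8)
        (solve 0 (con (+ 24) :* con (+ 9) := con (+ 2) :* con (+ 108)) refl)))))
    (*-congˡ (*-congˡ (*-identityʳ r))))

  -- Over 108: 144 - 24r + 19r² exceeds 135 by 3(1 - 8r) + 6 + 19r².
  5/4≤target : ∀ {r} → nat 8 * r ≤ nat 1 → nat 5 / nat 4 ≤ target r 0#
  5/4≤target {r} 8r≤1 = ≤-by _
    (*-nonNegative 0≤w (+-nonNegative (+-nonNegative (*-nonNegative (0≤nat 3) (x≤y⇒0≤y-x 8r≤1)) (0≤nat 6))
      (*-nonNegative (0≤nat 19) (0≤x² r))))
    (trans (target≈ r 0#) (trans
      (solve 2 (λ w r → con (+ 144) :* w :- con (+ 24) :* w :* r :+ con (+ 19) :* w :* (r :* r) :+ con (+ 0) :=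
          con (+ 135) :* w :+ w :* (con (+ 3) :* (con (+ 1) :- con (+ 8) :* r) :+ con (+ 6) :+ con (+ 19) :* (r :* r))) refl w r)
      (+-congʳ (sym (/≈*w (nat 135) (nat≉0 3)
        (solve 0 (con (+ 135) :* con (+ 4) := con (+ 5) :* con (+ 108)) refl))))))

  -- Over 108, with the error term 1 included: 252 - 24r + 19r² exceeds 216 by 24(1 - r) + 12 +
  -- 19r².
  2≤target : ∀ {r} → r ≤ 1# → nat 2 / nat 1 ≤ target r 1#
  2≤target {r} r≤1 = ≤-by _
    (*-nonNegative 0≤w (+-nonNegative (+-nonNegative (*-nonNegative (0≤nat 24)
      (x≤y⇒0≤y-x (≤-respʳ-≈ (sym (+-identityʳ 1#)) r≤1))) (0≤nat 12)) (*-nonNegative (0≤nat 19) (0≤x² r))))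
    (trans (target≈ r 1#) (trans (+-congˡ (sym 108w≈1)) (trans
      (solve 2 (λ w r → con (+ 144) :* w :- con (+ 24) :* w :* r :+ con (+ 19) :* w :* (r :* r) :+ con (+ 108) :* w :=
          con (+ 216) :* w :+ w :* (con (+ 24) :* (con (+ 1) :- r) :+ con (+ 12) :+ con (+ 19) :* (r :* r))) refl w r)
      (+-congʳ (sym (/≈*w (nat 216) (nat≉0 0)
        (solve 0 (con (+ 216) :* con (+ 1) := con (+ 2) :* con (+ 108)) refl)))))))

  braessRatio≤target : ∀ {r} m n (I : Instance (suc m) (suc n)) → r ≤ 1# → nat (suc n) ≈ r * nat (suc m) →
                       (p : Dec (nat 8 * r ≤ nat 1)) → Instance.braessRatio I ≤ target r (correction p)
  braessRatio≤target m n I r≤1 n≈rm (no _)     = ≤-trans (RatioBound.braessRatio≤2 ℝ m n I) (2≤target r≤1)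
  braessRatio≤target {r} m n I r≤1 n≈rm (yes 8r≤1) =
    ≤-trans (RatioBound.braessRatio≤5/4 ℝ m n I 8n≤m) (5/4≤target 8r≤1)
    where
    8n≤m : nat 8 * nat (suc n) ≤ nat (suc m)
    8n≤m = ≤-respˡ-≈ (sym (begin
      nat 8 * nat (suc n)       ≈⟨ *-congˡ n≈rm ⟩
      nat 8 * (r * nat (suc m)) ≈⟨ solve 3 (λ e r M → e :* (r :* M) :=
            M :* (e :* r)) refl (nat 8) r (nat (suc m)) ⟩
      nat (suc m) * (nat 8 * r) ∎))
      (≤-respʳ-≈ (trans (*-congˡ (+-identityʳ 1#)) (*-identityʳ _)) (*-monoˡ-≤ (0≤nat (suc m)) 8r≤1))

corollary4p2 : (ℝ : CompleteOrderedField) → let open Braess ℝ in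
    (β : ℕ → ℕ → ℝ±) → IsSupBraessRatio β →
    Σ[ g ∈ Function ] IsO[r³] g ×
    ((r : ⟨0,1]) → Rational (proj₁ r) →
    (L : ℝ±) → IsLimSupAlong (proj₁ r) β L →
    L ≤± [ nat 4 / nat 3 - (nat 2 / nat 9) * proj₁ r + (nat 19 / nat 108) * proj₁ r ^ 2 + g ⟨ r ⟩ ])
corollary4p2 ℝ β isSup = g , isO[r³] , λ (r , 0<r , r≤1) _ L isLimSup →
  limSup≤ isSup 0<r r≤1 isLimSup (λ m n I n≈rm → braessRatio≤target m n I r≤1 n≈rm (small? r))
  where open LimitBound ℝ
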